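{- Let $n, r$ be positive integers and let $V=\{e_1,\dots,e_n\}$ be the set of standard coordinate vectors of $\mathbb{R}^n$. Then the local $h$-polynomial of the $r$-fold edgewise subdivision $\mathrm{esd}_r(2^V)$ satisfies $$\ell_V(\mathrm{esd}_r(2^V),x) \;=\; \mathrm{E}_r\big((x+x^2+\cdots+x^{r-1})^n\big) \;=\; \sum_{w\in \mathcal{S}(n,r)} x^{\mathrm{asc}(w)}.$$
   Context: For $a=(a_1,\dots,a_n)\in\mathbb{Z}^n$ put $\iota(a)=(a_1,a_1+a_2,\dots,a_1+\cdots+a_n)$. Let $\Omega_r=\{(i_1,\dots,i_n)\in\mathbb{Z}_{\ge 0}^n : i_1+\cdots+i_n=r\}$. The $r$-fold edgewise subdivision $\mathrm{esd}_r(2^V)$ is the abstract simplicial complex on vertex set $\Omega_r$ in which a set $G\subseteq\Omega_r$ is a face iff for all $u,v\in G$, $\iota(u)-\iota(v)\in\{0,1\}^n$ or $\iota(v)-\iota(u)\in\{0,1\}^n$. It is realized as a triangulation of the simplex $\mathrm{conv}(\Omega_r)$ (a dilate of the simplex with vertex set $V$), cut by the hyperplanes $x_i+x_{i+1}+\cdots+x_j=k$ ($i\le j$, $k\in\{0,\dots,r\}$). For $F\subseteq V$, the restriction $\Gamma_F$ of $\Gamma=\mathrm{esd}_r(2^V)$ to $F$ is the subcomplex of faces all of whose vertices $u\in\Omega_r$ satisfy $u_i=0$ whenever $e_i\notin F$. The $h$-polynomial of a $(d-1)$-dimensional simplicial complex $\Delta$ is $h(\Delta,x)=\sum_{i=0}^d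 f_{i-1}(\Delta)x^i(1-x)^{d-i}$, where $f_{i}(\Delta)$ is the number of $i$-dimensional faces ($f_{ -1}=1$, counting the empty face); here $\Gamma_F$ is regarded as $(|F|-1)$-dimensional. The local $h$-polynomial of a triangulation $\Gamma$ of the simplex $2^V$ with $|V|=n$ is $\ell_V(\Gamma,x)=\sum_{F\subseteq V}(-1)^{n-|F|}h(\Gamma_F,x)$. $\mathrm{E}_r$ is the linear operator on $\mathbb{R}[x]$ with $\mathrm{E}_r(x^m)=x^{m/r}$ if $r$ divides $m$ and $\mathrm{E}_r(x^m)=0$ otherwise. $\mathcal{S}(n,r)$ is the set of sequences $w=(w_0,w_1,\dots,w_n)\in\{0,1,\dots,r-1\}^{n+1}$ with no two consecutive entries equal and with $w_0=w_n=0$. An ascent of $w$ is an index $i\in\{0,1,\dots,n-1\}$ with $w_i<w_{i+1}$, and $\mathrm{asc}(w)$ is the number of ascents. -}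

module Defs where

open import Data.Nat as ℕ using (ℕ; zero; suc; _∸_; _≤_)
open import Data.Integer as ℤ using (ℤ; +_; -1ℤ; 1ℤ; 0ℤ)
open import Data.Bool using (Bool; true; false; _∧_; if_then_else_)
open import Data.Fin using (Fin; toℕ)
open import Data.Vec as Vec using (Vec; []; _∷_)
open import Data.List as List using (List; []; _∷_; _++_; concatMap; map; filter; length; upTo; foldr)
open import Data.List.Relation.Unary.All using (All)
open import Data.Fin.Subset using (Subset; ∣_∣; _∈_; _∉_)
open import Relation.Nullary using (Dec; yes; no; ¬_)
open import Relation.Unary using (Decidable)
open import Relation.Binary.PropositionalEquality using (_≡_)
open import Data.Sum using (_⊎_)
open import Data.Product using (_×_)

-- Formal power series with integer coefficients (polynomials are those
-- of finite support); a series is its coefficient function.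

Series : Set
Series = ℕ → ℤ

sumℤ : List ℤ → ℤ
sumℤ = foldr ℤ._+_ 0ℤ

zeroS : Series
zeroS _ = 0ℤ

oneS : Series
oneS zero    = 1ℤ
oneS (suc _) = 0ℤ

monomial : ℕ → Series
monomial zero    zero    = 1ℤ
monomial zero    (suc _) = 0ℤ
monomial (suc m) zero    = 0ℤ
monomial (suc m) (suc k) = monomial m k

_⊕_ : Series → Series → Series
(p ⊕ q) k = p k ℤ.+ q k

scale : ℤ → Series → Series
scale c p k = c ℤ.* p k

_⊛_ : Series → Series → Series
(p ⊛ q) k = sumℤ (map (λ i → p i ℤ.* q (k ∸ i)) (upTo (suc k)))

powS : Series → ℕ → Series
powS p zero    = oneS
powS p (suc m) = p ⊛ powS p m

sumS : {A : Set} → List A → (A → Series) → Series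
sumS []       f = zeroS
sumS (a ∷ as) f = f a ⊕ sumS as f

-- the operator E_r : x^m ↦ x^(m/r) if r ∣ m, else 0   (r ≥ 1)
E : ℕ → Series → Series
E r p k = p (r ℕ.* k)

oneMinusX : Series
oneMinusX = oneS ⊕ scale -1ℤ (monomial 1)

allVecs : {A : Set} (n : ℕ) → List A → List (Vec A n)
allVecs zero    xs = [] ∷ []
allVecs (suc n) xs = concatMap (λ x → map (x ∷_) (allVecs n xs)) xs

sublists : {A : Set} → List A → List (List A)
sublists []       = [] ∷ []
sublists (x ∷ xs) = sublists xs ++ map (x ∷_) (sublists xs)

allFinL : (r : ℕ) → List (Fin r)
allFinL r = List.allFin r

sumV : {n : ℕ} → Vec ℕ n → ℕ
sumV = Vec.foldr _ ℕ._+_ 0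

Ω : (n r : ℕ) → List (Vec ℕ n)
Ω n r = filter (λ u → sumV u ℕ.≟ r) (allVecs n (upTo (suc r)))

ιaux : {n : ℕ} → ℤ → Vec ℕ n → Vec ℤ n
ιaux s []       = []
ιaux s (a ∷ as) = (s ℤ.+ + a) ∷ ιaux (s ℤ.+ + a) as

ι : {n : ℕ} → Vec ℕ n → Vec ℤ n
ι = ιaux 0ℤ

isBit : ℤ → Bool
isBit (+ 0) = true
isBit (+ 1) = true
isBit _     = false

diff01 : {n : ℕ} → Vec ℤ n → Vec ℤ n → Bool
diff01 []       []       = true
diff01 (a ∷ as) (b ∷ bs) = isBit (a ℤ.- b) ∧ diff01 as bs

compat : {n : ℕ} → Vec ℕ n → Vec ℕ n → Bool
compat u v = diff01 (ι u) (ι v) Data.Bool.∨ diff01 (ι v) (ι u)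

allB : {A : Set} → (A → Bool) → List A → Bool
allB p = foldr (λ a b → p a ∧ b) true

-- G is a face of esd_r(2^V)
isFace : {n : ℕ} → List (Vec ℕ n) → Bool
isFace G = allB (λ u → allB (λ v → compat u v) G) G

supportedIn : {n : ℕ} → Subset n → Vec ℕ n → Bool
supportedIn []          []       = true
supportedIn (true ∷ F)  (_ ∷ u)  = supportedIn F u
supportedIn (false ∷ F) (a ∷ u)  = (a ℕ.≡ᵇ 0) ∧ supportedIn F u

vertsF : {n : ℕ} → (r : ℕ) → Subset n → List (Vec ℕ n)
vertsF {n} r F = filter (λ u → Data.Bool._≟_ (supportedIn F u) true) (Ω n r)

-- faces of Γ_F (each exactly once, including the empty face)
facesF : {n : ℕ} → (r : ℕ) → Subset n → List (List (Vec ℕ n))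
facesF r F = filter (λ G → Data.Bool._≟_ (isFace G) true) (sublists (vertsF r F))

-- f_{i-1}(Γ_F) = number of faces with i vertices
fnum : {n : ℕ} → (r : ℕ) → Subset n → ℕ → ℕ
fnum r F i = length (filter (λ G → length G ℕ.≟ i) (facesF r F))

hPoly : {n : ℕ} → (r : ℕ) → Subset n → Series
hPoly r F = sumS (upTo (suc d))
  (λ i → scale (+ fnum r F i) (monomial i ⊛ powS oneMinusX (d ∸ i)))
  where d = ∣ F ∣

localH : (n r : ℕ) → Series
localH n r = sumS (allVecs n (true ∷ false ∷ []))
  (λ F → scale (-1ℤ ℤ.^ (n ∸ ∣ F ∣)) (hPoly r F))

geomS : ℕ → Series
geomS r = sumS (upTo r) (λ j → if j ℕ.≡ᵇ 0 then zeroS else monomial j)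

noConsecEq : {m : ℕ} {r : ℕ} → Vec (Fin r) m → Bool
noConsecEq []            = true
noConsecEq (_ ∷ [])      = true
noConsecEq (a ∷ b ∷ w)   = Data.Bool.not (toℕ a ℕ.≡ᵇ toℕ b) ∧ noConsecEq (b ∷ w)

asc : {m : ℕ} {r : ℕ} → Vec (Fin r) m → ℕ
asc []          = 0
asc (_ ∷ [])    = 0
asc (a ∷ b ∷ w) = (if toℕ a ℕ.<ᵇ toℕ b then 1 else 0) ℕ.+ asc (b ∷ w)

inS : {n r : ℕ} → Vec (Fin r) (suc n) → Bool
inS w = noConsecEq w ∧ (toℕ (Vec.head w) ℕ.≡ᵇ 0) ∧ (toℕ (Vec.last w) ℕ.≡ᵇ 0)

Sset : (n r : ℕ) → List (Vec (Fin r) (suc n))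
Sset n r = filter (λ w → Data.Bool._≟_ (inS w) true) (allVecs (suc n) (allFinL r))

ascPoly : (n r : ℕ) → Series
ascPoly n r = sumS (Sset n r) (λ w → monomial (asc w))

{-# OPTIONS --safe #-}
module Submission where

-- Write g = 1/(1 − x) and G = 1 + x + ⋯ + x^(r−1), so G = (1 − x^r) g.  The coefficient of x^k in
-- Σ (x/(1 − x))^|σ|, over the faces σ of esd_r(2^F), counts multisets of k vertices supported on a
-- face.  Ordered as chains u_1 ≤ ⋯ ≤ u_k, such multisets correspond under u_1 + ⋯ + u_k to the
-- vectors a ∈ ℕ^F with coordinate sum r k: the chain is recovered from the prefix sums c of a, since
-- those of its vertices are ⌊(c + m)/k⌋ for 0 ≤ m < k.  Hence the series is E_r(g^|F|), and
-- h(Γ_F) = (1 − x)^|F| E_r(g^|F|) = E_r(((1 − x^r) g)^|F|) = E_r(G^|F|).  The alternating sum over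
-- F is E_r((G − 1)^n) by the binomial theorem.
-- For the second equality, w ∈ S(n, r) is recorded by its steps (w_(i−1) − w_i) mod r ∈ {1, …, r−1};
-- their sum is r times the number of ascents.

open import Defs
open import Algebra.Bundles using (CommutativeRing)
import Algebra.Properties.CommutativeSemigroup as CommutativeSemigroupProperties
open import Algebra.Structures using (IsCommutativeRing)
open import Data.Bool using (Bool; true; false; if_then_else_; _∧_; _∨_; T)
import Data.Bool.Properties as Boolₚ
open import Data.Fin as Fin using (Fin; toℕ)
import Data.Fin.Properties as Finₚ
open import Data.Fin.Subset using (Subset; ∣_∣)
open import Data.Fin.Subset.Properties using (∣p∣≤n)
open import Data.Integer as ℤ using (ℤ; +_; -1ℤ; 1ℤ; 0ℤ)
import Data.Integer.Properties as ℤₚ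
open import Data.Integer.Tactic.RingSolver using (solve-∀)
open import Data.List as List using (List; []; _∷_; _++_; map; filter; length; upTo; applyUpTo; concatMap)
open import Data.List.Membership.Propositional using (_∈_)
import Data.List.Membership.Propositional.Properties as ∈ₚ
open import Data.List.Membership.Propositional.Properties.WithK using (unique∧set⇒bag)
import Data.List.Properties as Listₚ
open import Data.List.Relation.Binary.BagAndSetEquality using (∼bag⇒↭)
import Data.List.Relation.Binary.Permutation.Propositional.Properties as ↭ₚ
open import Data.List.Relation.Unary.All as All using (All; []; _∷_)
import Data.List.Relation.Unary.All.Properties as Allₚ
open import Data.List.Relation.Unary.AllPairs as AllPairs using (AllPairs; []; _∷_)
import Data.List.Relation.Unary.AllPairs.Properties as AllPairsₚ
open import Data.List.Relation.Unary.Any using (here; there)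
open import Data.List.Relation.Unary.Unique.Propositional using (Unique)
import Data.List.Relation.Unary.Unique.Propositional.Properties as Uniqueₚ
open import Data.Nat as ℕ using (ℕ; zero; suc; _∸_; _≤_; _<_; z≤n; s≤s)
import Data.Nat.Divisibility as ℕ∣
import Data.Nat.DivMod as ℕₚ
open import Data.Nat.ListAction using (sum)
import Data.Nat.Properties as ℕₚ
open import Data.Product using (_×_; _,_; proj₁; proj₂)
open import Data.Sum using (inj₁; inj₂)
open import Data.Unit using (tt)
open import Data.Vec as Vec using (Vec; []; _∷_)
import Data.Vec.Properties as Vecₚ
open import Data.Vec.Relation.Binary.Pointwise.Inductive as Pointwise using (Pointwise; []; _∷_)
open import Function using (_∘_; id)
open import Function.Bundles using (mk⇔)
open import Level using (0ℓ)
open import Relation.Binary.PropositionalEquality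
open import Relation.Nullary using (does; yes; no; ¬_; contradiction)
open import Relation.Unary using (Decidable)

-- The face condition is pairwise, so the complex is a clique complex: its series can be computed
-- one vertex at a time, by deletion and link, and the list of multisets supported on faces obeys
-- the same recursion. Two obstacles concern the order on a face. Compatibility forgets which of the
-- two differences of prefix sums lies in {0,1}^n, and the oriented relation is not transitive. The
-- direction comes back from the lexicographic order in which `Ω` lists the vertices, which never
-- contradicts the coordinatewise order of prefix sums; a chain is then a list whose entries are
-- related in all pairs, not just consecutively. The h-polynomial is cut off at |F| vertices, so it
-- becomes a sum over all faces only after the dimension of the complex has been bounded. In the
-- second equality, deleting the first letter of a word destroys the condition that it starts at 0.
-- The induction therefore runs over all start letters s at once, and the count for s is compared
-- with the coefficients in the degrees s + r k; E_r is the case s = 0.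

-- The commutative ring of formal power series

infix 4 _≋_
_≋_ : Series → Series → Set
p ≋ q = ∀ k → p k ≡ q k

tail : Series → Series
tail p k = p (suc k)

-- Distributivity, associativity and commutativity are proved by induction on the degree with this
-- recursion, which keeps the truncated subtraction `k ∸ i` out of sight.
⊛-suc : ∀ p q k → (p ⊛ q) (suc k) ≡ p 0 ℤ.* q (suc k) ℤ.+ (tail p ⊛ q) k
⊛-suc p q k = cong (λ l → p 0 ℤ.* q (suc k) ℤ.+ sumℤ l) (trans
  (Listₚ.map-applyUpTo suc (λ i → p i ℤ.* q (suc k ∸ i)) (suc k))
  (sym (Listₚ.map-applyUpTo id (λ i → p (suc i) ℤ.* q (k ∸ i)) (suc k))))

⊛-zero : ∀ p q → (p ⊛ q) 0 ≡ p 0 ℤ.* q 0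
⊛-zero p q = ℤₚ.+-identityʳ _

⊛-cong : ∀ {p p′ q q′} → p ≋ p′ → q ≋ q′ → p ⊛ q ≋ p′ ⊛ q′
⊛-cong {p} {p′} {q} {q′} e f k = cong sumℤ (Listₚ.map-cong (λ i → cong₂ ℤ._*_ (e i) (f (k ∸ i))) (upTo (suc k)))

-- The mirror image of `⊛-suc`, peeling the product at the other end. Commutativity follows because
-- exchanging the factors turns one recursion into the other.
⊛-sucʳ : ∀ p q k → (p ⊛ q) (suc k) ≡ (p ⊛ tail q) k ℤ.+ p (suc k) ℤ.* q 0
⊛-sucʳ p q zero = trans (⊛-suc p q 0) (cong₂ ℤ._+_ (sym (⊛-zero p (tail q))) (⊛-zero (tail p) q))
⊛-sucʳ p q (suc k) = begin
  (p ⊛ q) (suc (suc k))                                   ≡⟨ ⊛-suc p q (suc k) ⟩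
  a ℤ.+ (tail p ⊛ q) (suc k)                              ≡⟨ cong (ℤ._+_ a) (⊛-sucʳ (tail p) q k) ⟩
  a ℤ.+ ((tail p ⊛ tail q) k ℤ.+ p (2 ℕ.+ k) ℤ.* q 0)     ≡⟨ sym (ℤₚ.+-assoc a _ _) ⟩
  a ℤ.+ (tail p ⊛ tail q) k ℤ.+ p (2 ℕ.+ k) ℤ.* q 0       ≡⟨ cong (ℤ._+ (p (2 ℕ.+ k) ℤ.* q 0)) (sym (⊛-suc p (tail q) k)) ⟩
  (p ⊛ tail q) (suc k) ℤ.+ p (2 ℕ.+ k) ℤ.* q 0            ∎
  where open ≡-Reasoning
        a = p 0 ℤ.* q (2 ℕ.+ k)

⊛-comm : ∀ p q → p ⊛ q ≋ q ⊛ p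
⊛-comm p q zero = trans (⊛-zero p q) (trans (ℤₚ.*-comm (p 0) (q 0)) (sym (⊛-zero q p)))
⊛-comm p q (suc k) = begin
  (p ⊛ q) (suc k)                             ≡⟨ ⊛-suc p q k ⟩
  p 0 ℤ.* q (suc k) ℤ.+ (tail p ⊛ q) k        ≡⟨ cong₂ ℤ._+_ (ℤₚ.*-comm (p 0) _) (⊛-comm (tail p) q k) ⟩
  q (suc k) ℤ.* p 0 ℤ.+ (q ⊛ tail p) k        ≡⟨ ℤₚ.+-comm (q (suc k) ℤ.* p 0) _ ⟩
  (q ⊛ tail p) k ℤ.+ q (suc k) ℤ.* p 0        ≡⟨ sym (⊛-sucʳ q p k) ⟩
  (q ⊛ p) (suc k)                             ∎
  where open ≡-Reasoning

⊛-distribʳ : ∀ s p q → (p ⊕ q) ⊛ s ≋ (p ⊛ s) ⊕ (q ⊛ s)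
⊛-distribʳ s p q zero = begin
  ((p ⊕ q) ⊛ s) 0                       ≡⟨ ⊛-zero (p ⊕ q) s ⟩
  (p 0 ℤ.+ q 0) ℤ.* s 0                 ≡⟨ ℤₚ.*-distribʳ-+ (s 0) (p 0) (q 0) ⟩
  p 0 ℤ.* s 0 ℤ.+ q 0 ℤ.* s 0           ≡⟨ sym (cong₂ ℤ._+_ (⊛-zero p s) (⊛-zero q s)) ⟩
  ((p ⊛ s) ⊕ (q ⊛ s)) 0                 ∎
  where open ≡-Reasoning
⊛-distribʳ s p q (suc k) = begin
  ((p ⊕ q) ⊛ s) (suc k)                 ≡⟨ ⊛-suc (p ⊕ q) s k ⟩
  (p 0 ℤ.+ q 0) ℤ.* s (suc k) ℤ.+ ((tail p ⊕ tail q) ⊛ s) k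
    ≡⟨ cong (ℤ._+_ ((p 0 ℤ.+ q 0) ℤ.* s (suc k))) (⊛-distribʳ s (tail p) (tail q) k) ⟩
  (p 0 ℤ.+ q 0) ℤ.* s (suc k) ℤ.+ ((tail p ⊛ s) k ℤ.+ (tail q ⊛ s) k)
    ≡⟨ rearrange (p 0) (q 0) (s (suc k)) _ _ ⟩
  (p 0 ℤ.* s (suc k) ℤ.+ (tail p ⊛ s) k) ℤ.+ (q 0 ℤ.* s (suc k) ℤ.+ (tail q ⊛ s) k)
    ≡⟨ sym (cong₂ ℤ._+_ (⊛-suc p s k) (⊛-suc q s k)) ⟩
  ((p ⊛ s) ⊕ (q ⊛ s)) (suc k)           ∎
  where
  open ≡-Reasoning
  rearrange : ∀ a b c d e → (a ℤ.+ b) ℤ.* c ℤ.+ (d ℤ.+ e) ≡ (a ℤ.* c ℤ.+ d) ℤ.+ (b ℤ.* c ℤ.+ e)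
  rearrange = solve-∀

scale-⊛ : ∀ c p q → scale c p ⊛ q ≋ scale c (p ⊛ q)
scale-⊛ c p q zero = trans (⊛-zero (scale c p) q)
  (trans (ℤₚ.*-assoc c (p 0) (q 0)) (cong (c ℤ.*_) (sym (⊛-zero p q))))
scale-⊛ c p q (suc k) = begin
  (scale c p ⊛ q) (suc k)                                     ≡⟨ ⊛-suc (scale c p) q k ⟩
  c ℤ.* p 0 ℤ.* q (suc k) ℤ.+ (scale c (tail p) ⊛ q) k
    ≡⟨ cong₂ ℤ._+_ (ℤₚ.*-assoc c (p 0) _) (scale-⊛ c (tail p) q k) ⟩
  c ℤ.* (p 0 ℤ.* q (suc k)) ℤ.+ c ℤ.* (tail p ⊛ q) k          ≡⟨ sym (ℤₚ.*-distribˡ-+ c _ _) ⟩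
  c ℤ.* (p 0 ℤ.* q (suc k) ℤ.+ (tail p ⊛ q) k)                ≡⟨ cong (c ℤ.*_) (sym (⊛-suc p q k)) ⟩
  scale c (p ⊛ q) (suc k)                                     ∎
  where open ≡-Reasoning

⊛-assoc : ∀ p q s → (p ⊛ q) ⊛ s ≋ p ⊛ (q ⊛ s)
⊛-assoc p q s zero = begin
  ((p ⊛ q) ⊛ s) 0              ≡⟨ ⊛-zero (p ⊛ q) s ⟩
  (p ⊛ q) 0 ℤ.* s 0            ≡⟨ cong (ℤ._* s 0) (⊛-zero p q) ⟩
  p 0 ℤ.* q 0 ℤ.* s 0          ≡⟨ ℤₚ.*-assoc (p 0) (q 0) (s 0) ⟩
  p 0 ℤ.* (q 0 ℤ.* s 0)        ≡⟨ cong (p 0 ℤ.*_) (sym (⊛-zero q s)) ⟩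
  p 0 ℤ.* (q ⊛ s) 0            ≡⟨ sym (⊛-zero p (q ⊛ s)) ⟩
  (p ⊛ (q ⊛ s)) 0              ∎
  where open ≡-Reasoning
⊛-assoc p q s (suc k) = begin
  ((p ⊛ q) ⊛ s) (suc k)                       ≡⟨ ⊛-suc (p ⊛ q) s k ⟩
  (p ⊛ q) 0 ℤ.* s (suc k) ℤ.+ (tail (p ⊛ q) ⊛ s) k
    ≡⟨ cong₂ ℤ._+_ (cong (ℤ._* s (suc k)) (⊛-zero p q))
         (trans (⊛-cong {q = s} (⊛-suc p q) (λ _ → refl) k)
         (trans (⊛-distribʳ s (scale (p 0) (tail q)) (tail p ⊛ q) k)
           (cong₂ ℤ._+_ (scale-⊛ (p 0) (tail q) s k) (⊛-assoc (tail p) q s k)))) ⟩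
  p 0 ℤ.* q 0 ℤ.* s (suc k) ℤ.+ (p 0 ℤ.* (tail q ⊛ s) k ℤ.+ (tail p ⊛ (q ⊛ s)) k)
    ≡⟨ rearrange (p 0) (q 0) (s (suc k)) _ _ ⟩
  p 0 ℤ.* (q 0 ℤ.* s (suc k) ℤ.+ (tail q ⊛ s) k) ℤ.+ (tail p ⊛ (q ⊛ s)) k
    ≡⟨ cong (λ z → p 0 ℤ.* z ℤ.+ (tail p ⊛ (q ⊛ s)) k) (sym (⊛-suc q s k)) ⟩
  p 0 ℤ.* (q ⊛ s) (suc k) ℤ.+ (tail p ⊛ (q ⊛ s)) k   ≡⟨ sym (⊛-suc p (q ⊛ s) k) ⟩
  (p ⊛ (q ⊛ s)) (suc k)                       ∎
  where
  open ≡-Reasoning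
  rearrange : ∀ a b c d e → a ℤ.* b ℤ.* c ℤ.+ (a ℤ.* d ℤ.+ e) ≡ a ℤ.* (b ℤ.* c ℤ.+ d) ℤ.+ e
  rearrange = solve-∀

⊛-zeroˡ : ∀ q → zeroS ⊛ q ≋ zeroS
⊛-zeroˡ q zero    = refl
⊛-zeroˡ q (suc k) = trans (⊛-suc zeroS q k) (trans (ℤₚ.+-identityˡ _) (⊛-zeroˡ q k))

⊛-identityˡ : ∀ q → oneS ⊛ q ≋ q
⊛-identityˡ q zero    = trans (⊛-zero oneS q) (ℤₚ.*-identityˡ (q 0))
⊛-identityˡ q (suc k) = trans (⊛-suc oneS q k)
  (trans (cong₂ ℤ._+_ (ℤₚ.*-identityˡ (q (suc k))) (⊛-zeroˡ q k)) (ℤₚ.+-identityʳ _))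

⊛-identityʳ : ∀ q → q ⊛ oneS ≋ q
⊛-identityʳ q k = trans (⊛-comm q oneS k) (⊛-identityˡ q k)

⊛-distribˡ : ∀ s p q → s ⊛ (p ⊕ q) ≋ (s ⊛ p) ⊕ (s ⊛ q)
⊛-distribˡ s p q k = trans (⊛-comm s (p ⊕ q) k)
  (trans (⊛-distribʳ s p q k) (cong₂ ℤ._+_ (⊛-comm p s k) (⊛-comm q s k)))

⊛-⊕-isCommutativeRing : IsCommutativeRing _≋_ _⊕_ _⊛_ (λ p k → ℤ.- p k) zeroS oneS
⊛-⊕-isCommutativeRing = record
  { isRing = record
    { +-isAbelianGroup = record
      { isGroup = record
        { isMonoid = record
          { isSemigroup = record
            { isMagma = record
              { isEquivalence = record
                { refl = λ _ → refl ; sym = λ e k → sym (e k) ; trans = λ e f k → trans (e k) (f k) }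
              ; ∙-cong = λ e f k → cong₂ ℤ._+_ (e k) (f k) }
            ; assoc = λ p q s k → ℤₚ.+-assoc (p k) (q k) (s k) }
          ; identity = (λ p k → ℤₚ.+-identityˡ (p k)) , (λ p k → ℤₚ.+-identityʳ (p k)) }
        ; inverse = (λ p k → ℤₚ.+-inverseˡ (p k)) , (λ p k → ℤₚ.+-inverseʳ (p k))
        ; ⁻¹-cong = λ e k → cong ℤ.-_ (e k) }
      ; comm = λ p q k → ℤₚ.+-comm (p k) (q k) }
    ; *-cong = ⊛-cong
    ; *-assoc = ⊛-assoc
    ; *-identity = ⊛-identityˡ , ⊛-identityʳ
    ; distrib = ⊛-distribˡ , ⊛-distribʳ }
  ; *-comm = ⊛-comm }

seriesRing : CommutativeRing 0ℓ 0ℓ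
seriesRing = record { isCommutativeRing = ⊛-⊕-isCommutativeRing }

module S = CommutativeRing seriesRing

-- Multiplication by monomials, and finite sums of series

shift : ℕ → Series → Series
shift zero    q k       = q k
shift (suc j) q zero    = 0ℤ
shift (suc j) q (suc k) = shift j q k

monomial-zero : monomial 0 ≋ oneS
monomial-zero zero    = refl
monomial-zero (suc k) = refl

monomial-⊛ : ∀ j q → monomial j ⊛ q ≋ shift j q
monomial-⊛ zero    q k       = trans (⊛-cong {q = q} monomial-zero (λ _ → refl) k) (⊛-identityˡ q k)
monomial-⊛ (suc j) q zero    = refl
monomial-⊛ (suc j) q (suc k) = trans (⊛-suc (monomial (suc j)) q k)
  (trans (ℤₚ.+-identityˡ _) (monomial-⊛ j q k))

shift-< : ∀ {j} q {k} → k < j → shift j q k ≡ 0ℤ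
shift-< q {zero}  (s≤s _)   = refl
shift-< q {suc k} (s≤s k<j) = shift-< q k<j

shift-+ : ∀ j q k → shift j q (j ℕ.+ k) ≡ q k
shift-+ zero    q k = refl
shift-+ (suc j) q k = shift-+ j q k

shift-cong : ∀ j {p q} → p ≋ q → shift j p ≋ shift j q
shift-cong zero    e k       = e k
shift-cong (suc j) e zero    = refl
shift-cong (suc j) e (suc k) = shift-cong j e k

module _ {A : Set} where

  sumS-coeff : ∀ (L : List A) f k → sumS L f k ≡ sumℤ (map (λ a → f a k) L)
  sumS-coeff []      f k = refl
  sumS-coeff (a ∷ L) f k = cong (ℤ._+_ (f a k)) (sumS-coeff L f k)

  sumS-cong : ∀ (L : List A) {f g} → (∀ a → f a ≋ g a) → sumS L f ≋ sumS L g
  sumS-cong []      e k = refl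
  sumS-cong (a ∷ L) e k = cong₂ ℤ._+_ (e a k) (sumS-cong L e k)

  sumS-++ : ∀ (L M : List A) f → sumS (L ++ M) f ≋ sumS L f ⊕ sumS M f
  sumS-++ []      M f k = sym (ℤₚ.+-identityˡ _)
  sumS-++ (a ∷ L) M f k = trans (cong (ℤ._+_ (f a k)) (sumS-++ L M f k))
    (sym (ℤₚ.+-assoc (f a k) (sumS L f k) (sumS M f k)))

  sumS-zero : ∀ (L : List A) {f} → (∀ a → f a ≋ zeroS) → sumS L f ≋ zeroS
  sumS-zero []      e k = refl
  sumS-zero (a ∷ L) e k = cong₂ ℤ._+_ (e a k) (sumS-zero L e k)

  sumS-⊛ : ∀ (L : List A) f q → sumS L f ⊛ q ≋ sumS L (λ a → f a ⊛ q)
  sumS-⊛ []      f q k = ⊛-zeroˡ q k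
  sumS-⊛ (a ∷ L) f q k = trans (⊛-distribʳ q (f a) (sumS L f) k)
    (cong (ℤ._+_ ((f a ⊛ q) k)) (sumS-⊛ L f q k))

  sumS-filter : ∀ {P : A → Set} (P? : Decidable P) (L : List A) f →
    sumS (filter P? L) f ≋ sumS L (λ a → if does (P? a) then f a else zeroS)
  sumS-filter P? []      f k = refl
  sumS-filter P? (a ∷ L) f k with does (P? a)
  ... | true  = cong (ℤ._+_ (f a k)) (sumS-filter P? L f k)
  ... | false = trans (sumS-filter P? L f k) (sym (ℤₚ.+-identityˡ _))

shift-⊕ : ∀ c p q → shift c (p ⊕ q) ≋ shift c p ⊕ shift c q
shift-⊕ zero    p q k       = refl
shift-⊕ (suc c) p q zero    = refl
shift-⊕ (suc c) p q (suc k) = shift-⊕ c p q k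

shift-zeroS : ∀ c → shift c zeroS ≋ zeroS
shift-zeroS zero    k       = refl
shift-zeroS (suc c) zero    = refl
shift-zeroS (suc c) (suc k) = shift-zeroS c k

shift-sumS : ∀ {A : Set} c (L : List A) f → shift c (sumS L f) ≋ sumS L (λ a → shift c (f a))
shift-sumS c []      f k = shift-zeroS c k
shift-sumS c (a ∷ L) f k = trans (shift-⊕ c (f a) (sumS L f) k)
  (cong (ℤ._+_ (shift c (f a) k)) (shift-sumS c L f k))

sumS-branch : ∀ {A : Set} (L : List A) b c f →
  sumS L (λ a → if b then zeroS else shift c (f a)) ≋ (if b then zeroS else shift c (sumS L f))
sumS-branch L true  c f k = sumS-zero L (λ _ _ → refl) k
sumS-branch L false c f k = sym (shift-sumS c L f k)

sumS-map : ∀ {A B : Set} (g : A → B) (L : List A) f → sumS (map g L) f ≋ sumS L (f ∘ g)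
sumS-map g []      f k = refl
sumS-map g (a ∷ L) f k = cong (ℤ._+_ (f (g a) k)) (sumS-map g L f k)

sumS-concatMap : ∀ {A B : Set} (g : A → List B) (L : List A) f →
  sumS (concatMap g L) f ≋ sumS L (λ a → sumS (g a) f)
sumS-concatMap g []      f k = refl
sumS-concatMap g (a ∷ L) f k = trans (sumS-++ (g a) (concatMap g L) f k)
  (cong (ℤ._+_ (sumS (g a) f k)) (sumS-concatMap g L f k))

sumS-allVecs-suc : ∀ {A : Set} n (xs : List A) f →
  sumS (allVecs (suc n) xs) f ≋ sumS xs (λ x → sumS (allVecs n xs) (λ v → f (x ∷ v)))
sumS-allVecs-suc n xs f k = trans (sumS-concatMap (λ x → map (x ∷_) (allVecs n xs)) xs f k)
  (sumS-cong xs (λ x → sumS-map (x ∷_) (allVecs n xs) f) k)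

does-≟-true : ∀ b → does (b Boolₚ.≟ true) ≡ b
does-≟-true true  = refl
does-≟-true false = refl

≡ᵇ-false : ∀ {m n} → m ≢ n → (m ℕ.≡ᵇ n) ≡ false
≡ᵇ-false {m} {n} m≢n = Boolₚ.¬-not λ e → m≢n (ℕₚ.≡ᵇ⇒≡ m n (subst T (sym e) tt))

≡ᵇ-refl : ∀ m → (m ℕ.≡ᵇ m) ≡ true
≡ᵇ-refl zero    = refl
≡ᵇ-refl (suc m) = ≡ᵇ-refl m

<ᵇ-true : ∀ {m n} → m < n → (m ℕ.<ᵇ n) ≡ true
<ᵇ-true {zero}  (s≤s _)   = refl
<ᵇ-true {suc m} (s≤s m<n) = <ᵇ-true m<n

<ᵇ-false : ∀ {m n} → n ≤ m → (m ℕ.<ᵇ n) ≡ false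
<ᵇ-false z≤n       = refl
<ᵇ-false (s≤s n≤m) = <ᵇ-false n≤m

-- The second equality: words, their steps and their ascents

Σ< : ℕ → (ℕ → ℤ) → ℤ
Σ< m a = sumℤ (applyUpTo a m)

Σ<-cong : ∀ m {a b : ℕ → ℤ} → (∀ {i} → i < m → a i ≡ b i) → Σ< m a ≡ Σ< m b
Σ<-cong zero    e = refl
Σ<-cong (suc m) e = cong₂ ℤ._+_ (e (s≤s z≤n)) (Σ<-cong m (λ i<m → e (s≤s i<m)))

Σ<-+ : ∀ m n (a : ℕ → ℤ) → Σ< (m ℕ.+ n) a ≡ Σ< m a ℤ.+ Σ< n (λ i → a (m ℕ.+ i))
Σ<-+ zero    n a = sym (ℤₚ.+-identityˡ _)
Σ<-+ (suc m) n a = trans (cong (ℤ._+_ (a 0)) (Σ<-+ m n (a ∘ suc)))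
  (sym (ℤₚ.+-assoc (a 0) (Σ< m (a ∘ suc)) (Σ< n (λ i → a (suc m ℕ.+ i)))))

Σ<-reverse : ∀ m (a : ℕ → ℤ) → Σ< m a ≡ Σ< m (λ i → a (m ∸ suc i))
Σ<-reverse zero    a = refl
Σ<-reverse (suc m) a = begin
  a 0 ℤ.+ Σ< m (a ∘ suc)
    ≡⟨ cong₂ ℤ._+_ (cong a (sym (ℕₚ.n∸n≡0 m))) (Σ<-reverse m (a ∘ suc)) ⟩
  a (m ∸ m) ℤ.+ Σ< m (λ i → a (suc (m ∸ suc i)))
    ≡⟨ cong (ℤ._+_ (a (m ∸ m))) (Σ<-cong m (λ i<m → cong a (sym (ℕₚ.+-∸-assoc 1 i<m)))) ⟩
  a (m ∸ m) ℤ.+ Σ< m (λ i → a (m ∸ i))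
    ≡⟨ ℤₚ.+-comm (a (m ∸ m)) (Σ< m (λ i → a (m ∸ i))) ⟩
  Σ< m (λ i → a (m ∸ i)) ℤ.+ a (m ∸ m)
    ≡⟨ cong (ℤ._+_ (Σ< m (λ i → a (m ∸ i))))
         (trans (sym (ℤₚ.+-identityʳ _)) (cong (λ z → a (m ∸ z) ℤ.+ 0ℤ) (sym (ℕₚ.+-identityʳ m)))) ⟩
  Σ< m (λ i → a (m ∸ i)) ℤ.+ Σ< 1 (λ i → a (m ∸ (m ℕ.+ i)))
    ≡⟨ sym (Σ<-+ m 1 (λ i → a (m ∸ i))) ⟩
  Σ< (m ℕ.+ 1) (λ i → a (m ∸ i))
    ≡⟨ cong (λ l → Σ< l (λ i → a (m ∸ i))) (ℕₚ.+-comm m 1) ⟩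
  Σ< (suc m) (λ i → a (m ∸ i)) ∎
  where open ≡-Reasoning

tabulate-toℕ : ∀ r (h : ℕ → ℤ) → List.tabulate {n = r} (h ∘ toℕ) ≡ applyUpTo h r
tabulate-toℕ zero    h = refl
tabulate-toℕ (suc r) h = cong (h 0 ∷_) (tabulate-toℕ r (h ∘ suc))

sumℤ-allFin : ∀ r (h : ℕ → ℤ) → sumℤ (map (h ∘ toℕ) (allFinL r)) ≡ Σ< r h
sumℤ-allFin r h = cong sumℤ (trans (Listₚ.map-tabulate id (h ∘ toℕ)) (tabulate-toℕ r h))

geomS-⊛ : ∀ r q N → (geomS r ⊛ q) N ≡ Σ< r (λ j → if j ℕ.≡ᵇ 0 then 0ℤ else shift j q N)
geomS-⊛ r q N = begin
  (geomS r ⊛ q) N                          ≡⟨ sumS-⊛ (upTo r) _ q N ⟩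
  sumS (upTo r) (λ j → (if j ℕ.≡ᵇ 0 then zeroS else monomial j) ⊛ q) N
    ≡⟨ sumS-coeff (upTo r) _ N ⟩
  sumℤ (map (λ j → ((if j ℕ.≡ᵇ 0 then zeroS else monomial j) ⊛ q) N) (upTo r))
    ≡⟨ cong sumℤ (trans (Listₚ.map-cong term (upTo r)) (Listₚ.map-upTo _ r)) ⟩
  Σ< r (λ j → if j ℕ.≡ᵇ 0 then 0ℤ else shift j q N) ∎
  where
  open ≡-Reasoning
  term : ∀ j → ((if j ℕ.≡ᵇ 0 then zeroS else monomial j) ⊛ q) N ≡ (if j ℕ.≡ᵇ 0 then 0ℤ else shift j q N)
  term zero    = ⊛-zeroˡ q N
  term (suc j) = monomial-⊛ (suc j) q N

-- A step from letter s to letter t ≠ s has length (s − t) mod r; it is an ascent exactly when it wraps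
-- around.
geomS-⊛-residues : ∀ r s q k → s < r →
  (geomS r ⊛ q) (s ℕ.+ r ℕ.* k) ≡
  Σ< r (λ t → if s ℕ.≡ᵇ t then 0ℤ else
                shift (if s ℕ.<ᵇ t then 1 else 0) (λ k → q (t ℕ.+ r ℕ.* k)) k)
geomS-⊛-residues r s q k s<r = begin
  (geomS r ⊛ q) N                                     ≡⟨ geomS-⊛ r q N ⟩
  Σ< r a                                              ≡⟨ cong (λ z → Σ< z a) r≡ ⟩
  Σ< (suc s ℕ.+ m) a                                  ≡⟨ Σ<-+ (suc s) m a ⟩
  Σ< (suc s) a ℤ.+ Σ< m (λ i → a (suc s ℕ.+ i))
    -- Reversing each block changes the index from the step length j to the next letter t: j + t = s
    -- for j ≤ s, and j + t = s + r for the longer steps, which wrap around.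
    ≡⟨ cong₂ ℤ._+_ (Σ<-reverse (suc s) a) (Σ<-reverse m (λ i → a (suc s ℕ.+ i))) ⟩
  Σ< (suc s) (λ t → a (s ∸ t)) ℤ.+ Σ< m (λ i → a (suc s ℕ.+ (m ∸ suc i)))
    ≡⟨ cong₂ ℤ._+_ (Σ<-cong (suc s) (λ { (s≤s t≤s) → descent t≤s })) (Σ<-cong m (ascent k)) ⟩
  Σ< (suc s) (b k) ℤ.+ Σ< m (λ i → b k (suc s ℕ.+ i)) ≡⟨ sym (Σ<-+ (suc s) m (b k)) ⟩
  Σ< (suc s ℕ.+ m) (b k)                              ≡⟨ cong (λ z → Σ< z (b k)) (sym r≡) ⟩
  Σ< r (b k)                                          ∎
  where
  open ≡-Reasoning
  m = r ∸ suc s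
  r≡ : r ≡ suc s ℕ.+ m
  r≡ = sym (ℕₚ.m+[n∸m]≡n s<r)
  N = s ℕ.+ r ℕ.* k
  a′ : ℕ → ℕ → ℤ
  a′ k j = if j ℕ.≡ᵇ 0 then 0ℤ else shift j q (s ℕ.+ r ℕ.* k)
  a = a′ k
  b : ℕ → ℕ → ℤ
  b k t = if s ℕ.≡ᵇ t then 0ℤ else shift (if s ℕ.<ᵇ t then 1 else 0) (λ k → q (t ℕ.+ r ℕ.* k)) k
  descent : ∀ {t} → t ≤ s → a (s ∸ t) ≡ b k t
  descent {t} t≤s with s ℕ.≟ t
  ... | yes refl rewrite ℕₚ.n∸n≡0 s | ≡ᵇ-refl s = refl
  ... | no s≢t rewrite ≡ᵇ-false s≢t | <ᵇ-false t≤s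
                     | ≡ᵇ-false {s ∸ t} {0} (λ e → s≢t (ℕₚ.≤-antisym (ℕₚ.m∸n≡0⇒m≤n e) t≤s)) =
    trans (cong (shift (s ∸ t) q) (trans (cong (ℕ._+ r ℕ.* k) (sym (ℕₚ.m∸n+n≡m t≤s)))
                                         (ℕₚ.+-assoc (s ∸ t) t (r ℕ.* k))))
          (shift-+ (s ∸ t) q (t ℕ.+ r ℕ.* k))
  ascent : ∀ k {i} → i < m → a′ k (suc s ℕ.+ (m ∸ suc i)) ≡ b k (suc s ℕ.+ i)
  ascent k {i} i<m
    rewrite ≡ᵇ-false (ℕₚ.m≢1+m+n s {i}) | <ᵇ-true (ℕₚ.m≤m+n (suc s) i)
    with k
  ... | zero = shift-< q (subst (λ z → s ℕ.+ z < suc s ℕ.+ (m ∸ suc i)) (sym (ℕₚ.*-zeroʳ r))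
                 (subst (_< suc s ℕ.+ (m ∸ suc i)) (sym (ℕₚ.+-identityʳ s)) (ℕₚ.m≤m+n (suc s) _)))
  ... | suc k′ = trans (cong (shift j q) N≡) (shift-+ j q (suc s ℕ.+ i ℕ.+ r ℕ.* k′))
    where
    j = suc s ℕ.+ (m ∸ suc i)
    j+t≡ : j ℕ.+ (suc s ℕ.+ i) ≡ s ℕ.+ r
    j+t≡ = begin
      suc s ℕ.+ (m ∸ suc i) ℕ.+ (suc s ℕ.+ i)   ≡⟨ cong suc (ℕₚ.+-assoc s (m ∸ suc i) (suc s ℕ.+ i)) ⟩
      suc (s ℕ.+ (m ∸ suc i ℕ.+ suc (s ℕ.+ i))) ≡⟨ sym (ℕₚ.+-suc s _) ⟩
      s ℕ.+ suc (m ∸ suc i ℕ.+ suc (s ℕ.+ i))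
        ≡⟨ cong (λ z → s ℕ.+ z) (cong suc (trans (ℕₚ.+-suc _ _) (trans (cong (λ z → suc (m ∸ suc i ℕ.+ z)) (ℕₚ.+-comm s i))
             (trans (cong suc (sym (ℕₚ.+-assoc (m ∸ suc i) i s)))
             (trans (cong (ℕ._+ s) (trans (sym (ℕₚ.+-suc (m ∸ suc i) i)) (ℕₚ.m∸n+n≡m i<m))) (ℕₚ.+-comm m s)))))) ⟩
      s ℕ.+ suc (s ℕ.+ m)                       ≡⟨ cong (s ℕ.+_) (sym r≡) ⟩
      s ℕ.+ r ∎
    N≡ : s ℕ.+ r ℕ.* suc k′ ≡ j ℕ.+ (suc s ℕ.+ i ℕ.+ r ℕ.* k′)
    N≡ = begin
      s ℕ.+ r ℕ.* suc k′              ≡⟨ cong (s ℕ.+_) (ℕₚ.*-suc r k′) ⟩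
      s ℕ.+ (r ℕ.+ r ℕ.* k′)          ≡⟨ sym (ℕₚ.+-assoc s r _) ⟩
      s ℕ.+ r ℕ.+ r ℕ.* k′            ≡⟨ cong (ℕ._+ r ℕ.* k′) (sym j+t≡) ⟩
      j ℕ.+ (suc s ℕ.+ i) ℕ.+ r ℕ.* k′ ≡⟨ ℕₚ.+-assoc j _ _ ⟩
      j ℕ.+ (suc s ℕ.+ i ℕ.+ r ℕ.* k′) ∎

module _ {r : ℕ} where

  -- Only the end of the word is tied to 0. The start letter is free, since the tail of a word of
  -- S(n, r) may start anywhere.
  closedAsc : ∀ {n} → Fin r → Vec (Fin r) n → Series
  closedAsc s v = if noConsecEq (s ∷ v) ∧ (toℕ (Vec.last (s ∷ v)) ℕ.≡ᵇ 0)
                  then monomial (asc (s ∷ v)) else zeroS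

  closedAsc-∷ : ∀ {n} s t (v : Vec (Fin r) n) → closedAsc s (t ∷ v) ≋
    (if toℕ s ℕ.≡ᵇ toℕ t then zeroS else shift (if toℕ s ℕ.<ᵇ toℕ t then 1 else 0) (closedAsc t v))
  closedAsc-∷ s t v k with toℕ s ℕ.≡ᵇ toℕ t
  ... | true  = refl
  ... | false with toℕ s ℕ.<ᵇ toℕ t
  ...   | false = refl
  ...   | true  with noConsecEq (t ∷ v) ∧ (toℕ (Vec.last (t ∷ v)) ℕ.≡ᵇ 0)
  ...     | true  with k
  ...       | zero  = refl
  ...       | suc _ = refl
  closedAsc-∷ s t v k | false | true | false with k
  ... | zero  = refl
  ... | suc _ = refl

  wordsFrom : ℕ → Fin r → Series
  wordsFrom n s = sumS (allVecs n (allFinL r)) (closedAsc s)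

  wordsFrom-suc : ∀ n s → wordsFrom (suc n) s ≋
    sumS (allFinL r) (λ t → if toℕ s ℕ.≡ᵇ toℕ t then zeroS else
                              shift (if toℕ s ℕ.<ᵇ toℕ t then 1 else 0) (wordsFrom n t))
  wordsFrom-suc n s k = trans (sumS-allVecs-suc n (allFinL r) _ k) (sumS-cong (allFinL r) (λ t k →
    trans (sumS-cong (allVecs n (allFinL r)) (closedAsc-∷ s t) k)
          (sumS-branch (allVecs n (allFinL r)) (toℕ s ℕ.≡ᵇ toℕ t) (if toℕ s ℕ.<ᵇ toℕ t then 1 else 0) (closedAsc t) k)) k)

  -- The steps (w_(i-1) - w_i) mod r of a word add up to w_0 - w_n plus r for each ascent. A word
  -- from s to 0 with k ascents thus has step sum s + r k, and its steps are arbitrary elements of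
  -- {1, ..., r-1}.
  wordsFrom-E : ∀ n s k → wordsFrom n s k ≡ powS (geomS r) n (toℕ s ℕ.+ r ℕ.* k)
  wordsFrom-E zero s k = trans (ℤₚ.+-identityʳ _) (base s k)
    where
    base : ∀ {r} (s : Fin r) k → (if toℕ s ℕ.≡ᵇ 0 then monomial 0 else zeroS) k ≡ oneS (toℕ s ℕ.+ r ℕ.* k)
    base {suc r} Fin.zero    zero    rewrite ℕₚ.*-zeroʳ r = refl
    base {suc r} Fin.zero    (suc k) = refl
    base         (Fin.suc s) k       = refl
  wordsFrom-E (suc n) s k = begin
    wordsFrom (suc n) s k                                   ≡⟨ wordsFrom-suc n s k ⟩
    sumS (allFinL r) (λ t → step t (wordsFrom n t)) k       ≡⟨ sumS-coeff (allFinL r) _ k ⟩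
    sumℤ (map (λ t → step t (wordsFrom n t) k) (allFinL r)) ≡⟨ cong sumℤ (Listₚ.map-cong step-E (allFinL r)) ⟩
    sumℤ (map (h ∘ toℕ) (allFinL r))                        ≡⟨ sumℤ-allFin r h ⟩
    Σ< r h                                                  ≡⟨ sym (geomS-⊛-residues r (toℕ s) Q k (Finₚ.toℕ<n s)) ⟩
    (geomS r ⊛ Q) (toℕ s ℕ.+ r ℕ.* k)                       ∎
    where
    open ≡-Reasoning
    Q = powS (geomS r) n
    step : Fin r → Series → Series
    step t p = if toℕ s ℕ.≡ᵇ toℕ t then zeroS else shift (if toℕ s ℕ.<ᵇ toℕ t then 1 else 0) p
    h : ℕ → ℤ
    h t = if toℕ s ℕ.≡ᵇ t then 0ℤ else shift (if toℕ s ℕ.<ᵇ t then 1 else 0) (λ k → Q (t ℕ.+ r ℕ.* k)) k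
    step-E : ∀ t → step t (wordsFrom n t) k ≡ h (toℕ t)
    step-E t with toℕ s ℕ.≡ᵇ toℕ t
    ... | true  = refl
    ... | false = shift-cong (if toℕ s ℕ.<ᵇ toℕ t then 1 else 0) (wordsFrom-E n t) k

ascPoly-wordsFrom : ∀ n r → ascPoly n (suc r) ≋ wordsFrom n Fin.zero
ascPoly-wordsFrom n r k = begin
  ascPoly n (suc r) k
    ≡⟨ sumS-filter (λ w → inS w Boolₚ.≟ true) (allVecs (suc n) L) (λ w → monomial (asc w)) k ⟩
  sumS (allVecs (suc n) L) (λ w → if does (inS w Boolₚ.≟ true) then monomial (asc w) else zeroS) k
    ≡⟨ sumS-allVecs-suc n L _ k ⟩
  sumS (allVecs n L) (g Fin.zero) k ℤ.+ sumS (List.tabulate Fin.suc) (λ s → sumS (allVecs n L) (g s)) k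
    ≡⟨ cong₂ ℤ._+_ (sumS-cong (allVecs n L) starts-at-zero k) rest-zero ⟩
  wordsFrom n Fin.zero k ℤ.+ 0ℤ
    ≡⟨ ℤₚ.+-identityʳ _ ⟩
  wordsFrom n Fin.zero k ∎
  where
  open ≡-Reasoning
  L = allFinL (suc r)
  g : Fin (suc r) → Vec (Fin (suc r)) n → Series
  g s v = if does (inS (s ∷ v) Boolₚ.≟ true) then monomial (asc (s ∷ v)) else zeroS
  starts-at-zero : ∀ v → g Fin.zero v ≋ closedAsc Fin.zero v
  starts-at-zero v k rewrite does-≟-true (inS (Fin.zero {r} ∷ v)) = refl
  g-suc : ∀ s v → g (Fin.suc s) v ≋ zeroS
  g-suc s v k rewrite Boolₚ.∧-zeroʳ (noConsecEq (Fin.suc s ∷ v)) = refl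
  rest-zero : sumS (List.tabulate Fin.suc) (λ s → sumS (allVecs n L) (g s)) k ≡ 0ℤ
  rest-zero = trans (cong (λ l → sumS l (λ s → sumS (allVecs n L) (g s)) k) (sym (Listₚ.map-tabulate id Fin.suc)))
    (trans (sumS-map Fin.suc (allFinL r) _ k)
           (sumS-zero (allFinL r) (λ s → sumS-zero (allVecs n L) (g-suc s)) k))

E-geomS-ascPoly : ∀ n r → 1 ≤ r → E r (powS (geomS r) n) ≋ ascPoly n r
E-geomS-ascPoly n (suc r) _ k = trans (sym (wordsFrom-E n Fin.zero k)) (sym (ascPoly-wordsFrom n r k))

-- The operator E_r and the factors 1 - x^r

module ⊛ = CommutativeSemigroupProperties S.*-commutativeSemigroup
module ℤ+ = CommutativeSemigroupProperties ℤₚ.+-commutativeSemigroup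

powS-cong : ∀ {p q} n → p ≋ q → powS p n ≋ powS q n
powS-cong zero    e = S.refl
powS-cong (suc n) e = S.*-cong e (powS-cong n e)

powS-⊛ : ∀ p q n → powS (p ⊛ q) n ≋ powS p n ⊛ powS q n
powS-⊛ p q zero    = S.sym (S.*-identityˡ oneS)
powS-⊛ p q (suc n) = S.trans (S.*-congˡ {p ⊛ q} (powS-⊛ p q n)) (⊛.interchange p q (powS p n) (powS q n))

⊛-sumS : ∀ {A : Set} q (L : List A) f → q ⊛ sumS L f ≋ sumS L (λ a → q ⊛ f a)
⊛-sumS q L f = S.trans (S.*-comm q (sumS L f))
  (S.trans (sumS-⊛ L f q) (sumS-cong L (λ a → S.*-comm (f a) q)))

scale-sumS : ∀ {A : Set} c (L : List A) f → scale c (sumS L f) ≋ sumS L (λ a → scale c (f a))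
scale-sumS c []      f k = ℤₚ.*-zeroʳ c
scale-sumS c (a ∷ L) f k = trans (ℤₚ.*-distribˡ-+ c (f a k) (sumS L f k))
  (cong (ℤ._+_ (c ℤ.* f a k)) (scale-sumS c L f k))

oneMinusX^ : ℕ → Series
oneMinusX^ r = oneS ⊕ scale -1ℤ (monomial r)

oneMinusX^-⊛ : ∀ r p → oneMinusX^ r ⊛ p ≋ p ⊕ scale -1ℤ (shift r p)
oneMinusX^-⊛ r p k = trans (⊛-distribʳ p oneS (scale -1ℤ (monomial r)) k)
  (cong₂ ℤ._+_ (⊛-identityˡ p k)
    (trans (scale-⊛ -1ℤ (monomial r) p k) (cong (ℤ._*_ -1ℤ) (monomial-⊛ r p k))))

-- The series 1/(1 - x); its d-th power counts the vectors of ℕ^d by coordinate sum.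
ones : Series
ones _ = 1ℤ

shift-ones : ∀ r k → shift r ones k ≡ monomial r k ℤ.+ shift (suc r) ones k
shift-ones zero    zero    = refl
shift-ones zero    (suc k) = refl
shift-ones (suc r) zero    = refl
shift-ones (suc r) (suc k) = shift-ones r k

oneMinusX^-ones : ∀ r → 1 ≤ r → oneMinusX^ r ⊛ ones ≋ oneS ⊕ geomS r
oneMinusX^-ones (suc r) _ k = trans (oneMinusX^-⊛ (suc r) ones k) (sym (truncated r k))
  where
  open ≡-Reasoning
  term : ℕ → Series
  term j = if j ℕ.≡ᵇ 0 then zeroS else monomial j
  geomS-suc : ∀ m k → geomS (suc m) k ≡ geomS m k ℤ.+ term m k
  geomS-suc m k = trans (cong (λ l → sumS l term k) (sym (Listₚ.upTo-∷ʳ m)))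
    (trans (sumS-++ (upTo m) (m ∷ []) term k) (cong (ℤ._+_ (geomS m k)) (ℤₚ.+-identityʳ (term m k))))
  cancel : ∀ a b → 1ℤ ℤ.+ -1ℤ ℤ.* (a ℤ.+ b) ℤ.+ a ≡ 1ℤ ℤ.+ -1ℤ ℤ.* b
  cancel = solve-∀
  truncated : ∀ r k → oneS k ℤ.+ geomS (suc r) k ≡ 1ℤ ℤ.+ -1ℤ ℤ.* shift (suc r) ones k
  truncated zero    zero    = refl
  truncated zero    (suc k) = refl
  truncated (suc r) k = begin
    oneS k ℤ.+ geomS (2 ℕ.+ r) k                       ≡⟨ cong (ℤ._+_ (oneS k)) (geomS-suc (suc r) k) ⟩
    oneS k ℤ.+ (geomS (suc r) k ℤ.+ monomial (suc r) k) ≡⟨ sym (ℤₚ.+-assoc (oneS k) _ _) ⟩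
    oneS k ℤ.+ geomS (suc r) k ℤ.+ monomial (suc r) k   ≡⟨ cong (ℤ._+ monomial (suc r) k) (truncated r k) ⟩
    1ℤ ℤ.+ -1ℤ ℤ.* shift (suc r) ones k ℤ.+ monomial (suc r) k
      ≡⟨ cong (λ z → 1ℤ ℤ.+ -1ℤ ℤ.* z ℤ.+ monomial (suc r) k) (shift-ones (suc r) k) ⟩
    1ℤ ℤ.+ -1ℤ ℤ.* (monomial (suc r) k ℤ.+ shift (2 ℕ.+ r) ones k) ℤ.+ monomial (suc r) k
      ≡⟨ cancel (monomial (suc r) k) (shift (2 ℕ.+ r) ones k) ⟩
    1ℤ ℤ.+ -1ℤ ℤ.* shift (2 ℕ.+ r) ones k ∎

E-cong : ∀ r {p q} → p ≋ q → E r p ≋ E r q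
E-cong r e k = e (r ℕ.* k)

E-shift : ∀ r → 1 ≤ r → ∀ p → E r (shift r p) ≋ shift 1 (E r p)
E-shift r 1≤r p zero    = shift-< p (subst (_< r) (sym (ℕₚ.*-zeroʳ r)) 1≤r)
E-shift r 1≤r p (suc k) = trans (cong (shift r p) (ℕₚ.*-suc r k)) (shift-+ r p (r ℕ.* k))

-- `E r` is not multiplicative, but a factor that is a series in x^r passes through it with x^r
-- replaced by x. This is how the (1 - x)^d in front of an h-polynomial moves under the operator.
E-oneMinusX^ : ∀ r → 1 ≤ r → ∀ p → E r (oneMinusX^ r ⊛ p) ≋ oneMinusX ⊛ E r p
E-oneMinusX^ r 1≤r p k = trans (oneMinusX^-⊛ r p (r ℕ.* k))
  (trans (cong (λ z → E r p k ℤ.+ -1ℤ ℤ.* z) (E-shift r 1≤r p k)) (sym (oneMinusX^-⊛ 1 (E r p) k)))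

E-powS-oneMinusX^ : ∀ r → 1 ≤ r → ∀ d p → E r (powS (oneMinusX^ r) d ⊛ p) ≋ powS oneMinusX d ⊛ E r p
E-powS-oneMinusX^ r 1≤r zero    p = S.trans (E-cong r (S.*-identityˡ p)) (S.sym (S.*-identityˡ (E r p)))
E-powS-oneMinusX^ r 1≤r (suc d) p =
  S.trans (E-cong r (S.*-assoc (oneMinusX^ r) (powS (oneMinusX^ r) d) p))
  (S.trans (E-oneMinusX^ r 1≤r (powS (oneMinusX^ r) d ⊛ p))
  (S.trans (S.*-congˡ {oneMinusX} (E-powS-oneMinusX^ r 1≤r d p))
           (S.sym (S.*-assoc oneMinusX (powS oneMinusX d) (E r p)))))

E-powS-ones : ∀ r → 1 ≤ r → ∀ d → powS oneMinusX d ⊛ E r (powS ones d) ≋ E r (powS (oneS ⊕ geomS r) d)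
E-powS-ones r 1≤r d = S.trans (S.sym (E-powS-oneMinusX^ r 1≤r d (powS ones d)))
  (E-cong r (S.trans (S.sym (powS-⊛ (oneMinusX^ r) ones d)) (powS-cong d (oneMinusX^-ones r 1≤r))))

-- The h-polynomial as a sum over faces, and the alternating sum over subsets

X/1-X : Series
X/1-X = shift 1 ones

-- The factor x/(1 - x) records a vertex of positive multiplicity. One copy is split off as x; then
-- the vertex is either used up or still has positive multiplicity. The recursion of `multicliques`
-- has the same two cases.
X/1-X-unfold : ∀ p → X/1-X ⊛ p ≋ shift 1 (p ⊕ (X/1-X ⊛ p))
X/1-X-unfold p = S.trans (S.*-congʳ {p} unfold) (S.trans (S.*-assoc (monomial 1) (oneS ⊕ X/1-X) p)
  (S.trans (monomial-⊛ 1 ((oneS ⊕ X/1-X) ⊛ p)) (shift-cong 1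
    (S.trans (S.distribʳ p oneS X/1-X) (S.+-congʳ {X/1-X ⊛ p} (S.*-identityˡ p))))))
  where
  unfold : X/1-X ≋ monomial 1 ⊛ (oneS ⊕ X/1-X)
  unfold zero    = refl
  unfold (suc k) = sym (trans (monomial-⊛ 1 (oneS ⊕ X/1-X) (suc k)) (1⊕X/1-X k))
    where
    1⊕X/1-X : oneS ⊕ X/1-X ≋ ones
    1⊕X/1-X zero    = refl
    1⊕X/1-X (suc k) = refl

oneMinusX-X/1-X : oneMinusX ⊛ X/1-X ≋ monomial 1
oneMinusX-X/1-X zero          = refl
oneMinusX-X/1-X (suc zero)    = oneMinusX^-⊛ 1 X/1-X 1
oneMinusX-X/1-X (suc (suc k)) = oneMinusX^-⊛ 1 X/1-X (suc (suc k))

-- Each of the i factors x is written as (1 - x) · x/(1 - x), which completes (1 - x)^(d-i) to (1 -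
-- x)^d. The power of 1 - x no longer depends on the face and can be taken out of the sum over
-- faces.
monomial-⊛-oneMinusX : ∀ {i d} → i ≤ d →
  monomial i ⊛ powS oneMinusX (d ∸ i) ≋ powS oneMinusX d ⊛ powS X/1-X i
monomial-⊛-oneMinusX {d = d} z≤n =
  S.trans (S.*-congʳ {powS oneMinusX d} monomial-zero) (S.*-comm oneS (powS oneMinusX d))
monomial-⊛-oneMinusX {suc i} {suc d} (s≤s i≤d) =
  S.trans (monomial-⊛ (suc i) P)
  (S.trans (λ { zero → refl ; (suc k) → sym (monomial-⊛ i P k) })
  (S.trans (S.sym (monomial-⊛ 1 (monomial i ⊛ P)))
  (S.trans (S.*-cong (S.sym oneMinusX-X/1-X) (monomial-⊛-oneMinusX i≤d))
           (⊛.interchange oneMinusX X/1-X (powS oneMinusX d) (powS X/1-X i)))))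
  where P = powS oneMinusX (d ∸ i)

Σ<-indicator : ∀ {w d} → w ≤ d → ∀ (a : ℕ → ℤ) → Σ< (suc d) (λ i → if w ℕ.≡ᵇ i then a i else 0ℤ) ≡ a w
Σ<-indicator {zero} {d} z≤n a = trans (cong (ℤ._+_ (a 0)) (zeros d)) (ℤₚ.+-identityʳ (a 0))
  where
  zeros : ∀ d → Σ< d (λ _ → 0ℤ) ≡ 0ℤ
  zeros zero    = refl
  zeros (suc d) = trans (ℤₚ.+-identityˡ _) (zeros d)
Σ<-indicator {suc w} {suc d} (s≤s w≤d) a = trans (ℤₚ.+-identityˡ _) (Σ<-indicator w≤d (a ∘ suc))

-- Each entry `a` is counted in exactly one of the fibres, the one over `w a`, which the bound
-- places within the range of summation. With `length` for `w` this passes from face numbers to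
-- faces.
sumS-fibres : ∀ {A : Set} (w : A → ℕ) (L : List A) d (φ : ℕ → Series) → All (λ a → w a ≤ d) L →
  sumS (upTo (suc d)) (λ i → scale (+ length (filter (λ a → w a ℕ.≟ i) L)) (φ i)) ≋ sumS L (φ ∘ w)
sumS-fibres w []      d φ []          k = sumS-zero (upTo (suc d)) (λ _ _ → refl) k
sumS-fibres w (a ∷ L) d φ (wa≤d ∷ ws) k = begin
  sumS (upTo (suc d)) (λ i → scale (+ count (a ∷ L) i) (φ i)) k
    ≡⟨ sumS-cong (upTo (suc d)) split k ⟩
  sumS (upTo (suc d)) (λ i → one i ⊕ scale (+ count L i) (φ i)) k
    ≡⟨ sumS-⊕ (upTo (suc d)) one _ k ⟩
  sumS (upTo (suc d)) one k ℤ.+ sumS (upTo (suc d)) (λ i → scale (+ count L i) (φ i)) k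
    ≡⟨ cong₂ ℤ._+_ one-sum (sumS-fibres w L d φ ws k) ⟩
  φ (w a) k ℤ.+ sumS L (φ ∘ w) k ∎
  where
  open ≡-Reasoning
  count : List _ → ℕ → ℕ
  count L i = length (filter (λ a → w a ℕ.≟ i) L)
  one : ℕ → Series
  one i k = if w a ℕ.≡ᵇ i then φ i k else 0ℤ
  one-sum : sumS (upTo (suc d)) one k ≡ φ (w a) k
  one-sum = trans (sumS-coeff (upTo (suc d)) one k)
    (trans (cong sumℤ (Listₚ.map-upTo (λ i → one i k) (suc d))) (Σ<-indicator wa≤d (λ i → φ i k)))
  suc-* : ∀ c x → (1ℤ ℤ.+ c) ℤ.* x ≡ x ℤ.+ c ℤ.* x
  suc-* = solve-∀
  split : ∀ i → scale (+ count (a ∷ L) i) (φ i) ≋ one i ⊕ scale (+ count L i) (φ i)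
  split i k with w a ℕ.≡ᵇ i
  ... | true  = suc-* (+ count L i) (φ i k)
  ... | false = sym (ℤₚ.+-identityˡ _)
  sumS-⊕ : ∀ {B : Set} (M : List B) f g → sumS M (λ b → f b ⊕ g b) ≋ sumS M f ⊕ sumS M g
  sumS-⊕ []      f g k = refl
  sumS-⊕ (b ∷ M) f g k = trans (cong (ℤ._+_ (f b k ℤ.+ g b k)) (sumS-⊕ M f g k))
    (ℤ+.interchange (f b k) (g b k) (sumS M f k) (sumS M g k))

-- Splitting on the first element: the subsets that contain it gain a factor 1 + p, the others a
-- factor -1, so every element contributes (1 + p) - 1 = p.
alternating-subsets : ∀ p n →
  sumS (allVecs n (true ∷ false ∷ [])) (λ F → scale (-1ℤ ℤ.^ (n ∸ ∣ F ∣)) (powS (oneS ⊕ p) ∣ F ∣)) ≋ powS p n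
alternating-subsets p zero    k = trans (ℤₚ.+-identityʳ _) (ℤₚ.*-identityˡ _)
alternating-subsets p (suc n) k = begin
  sumS (allVecs (suc n) bits) (term (suc n)) k
    ≡⟨ sumS-allVecs-suc n bits (term (suc n)) k ⟩
  sumS subsets (λ F → term (suc n) (true ∷ F)) k ℤ.+ (sumS subsets (λ F → term (suc n) (false ∷ F)) k ℤ.+ 0ℤ)
    ≡⟨ cong₂ (λ a b → a ℤ.+ (b ℤ.+ 0ℤ)) inside outside ⟩
  ((oneS ⊕ p) ⊛ B) k ℤ.+ (-1ℤ ℤ.* B k ℤ.+ 0ℤ)
    ≡⟨ cong (λ z → z ℤ.+ (-1ℤ ℤ.* B k ℤ.+ 0ℤ)) (trans (⊛-distribʳ B oneS p k) (cong (ℤ._+ (p ⊛ B) k) (⊛-identityˡ B k))) ⟩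
  B k ℤ.+ (p ⊛ B) k ℤ.+ (-1ℤ ℤ.* B k ℤ.+ 0ℤ)
    ≡⟨ cancel (B k) ((p ⊛ B) k) ⟩
  (p ⊛ B) k
    ≡⟨ ⊛-cong {p} (λ _ → refl) (alternating-subsets p n) k ⟩
  (p ⊛ powS p n) k ∎
  where
  open ≡-Reasoning
  bits = true ∷ false ∷ []
  subsets = allVecs n bits
  term : ∀ n → Subset n → Series
  term n F = scale (-1ℤ ℤ.^ (n ∸ ∣ F ∣)) (powS (oneS ⊕ p) ∣ F ∣)
  B = sumS subsets (term n)
  cancel : ∀ a b → a ℤ.+ b ℤ.+ (-1ℤ ℤ.* a ℤ.+ 0ℤ) ≡ b
  cancel = solve-∀
  inside : sumS subsets (λ F → term (suc n) (true ∷ F)) k ≡ ((oneS ⊕ p) ⊛ B) k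
  inside = trans (sumS-cong subsets (λ F → pull (-1ℤ ℤ.^ (n ∸ ∣ F ∣)) (powS (oneS ⊕ p) ∣ F ∣)) k)
                 (sym (⊛-sumS (oneS ⊕ p) subsets (term n) k))
    where
    pull : ∀ c q → scale c ((oneS ⊕ p) ⊛ q) ≋ (oneS ⊕ p) ⊛ scale c q
    pull c q k = trans (cong (c ℤ.*_) (⊛-comm (oneS ⊕ p) q k))
      (trans (sym (scale-⊛ c q (oneS ⊕ p) k)) (⊛-comm (scale c q) (oneS ⊕ p) k))
  outside : sumS subsets (λ F → term (suc n) (false ∷ F)) k ≡ -1ℤ ℤ.* B k
  outside = trans (sumS-cong subsets negate k) (sym (scale-sumS -1ℤ subsets (term n) k))
    where
    negate : ∀ F → term (suc n) (false ∷ F) ≋ scale -1ℤ (term n F)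
    negate F k = trans (cong (λ e → -1ℤ ℤ.^ e ℤ.* powS (oneS ⊕ p) ∣ F ∣ k) (ℕₚ.+-∸-assoc 1 (∣p∣≤n F)))
      (ℤₚ.*-assoc -1ℤ (-1ℤ ℤ.^ (n ∸ ∣ F ∣)) (powS (oneS ⊕ p) ∣ F ∣ k))

-- Clique complexes and multisets supported on cliques

filterT : {A : Set} → (A → Bool) → List A → List A
filterT p = filter (λ a → p a Boolₚ.≟ true)

∧-true : ∀ {a b} → a ∧ b ≡ true → a ≡ true × b ≡ true
∧-true {true} e = refl , e

module _ {A : Set} where

  allB-∧ : ∀ (p q : A → Bool) L → allB (λ a → p a ∧ q a) L ≡ allB p L ∧ allB q L
  allB-∧ p q []      = refl
  allB-∧ p q (a ∷ L) rewrite allB-∧ p q L with p a | q a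
  ... | true  | true  = refl
  ... | true  | false = sym (Boolₚ.∧-zeroʳ (allB p L))
  ... | false | _     = refl

  allB-cong : ∀ {p q : A → Bool} → p ≗ q → allB p ≗ allB q
  allB-cong e []      = refl
  allB-cong e (a ∷ L) = cong₂ _∧_ (e a) (allB-cong e L)

  allB⇒All : ∀ (p : A → Bool) L → allB p L ≡ true → All (λ a → p a ≡ true) L
  allB⇒All p []      e = []
  allB⇒All p (a ∷ L) e = let pa , pL = ∧-true e in pa ∷ allB⇒All p L pL

  -- With `adj a` for `p`, this replaces the cliques that can be extended by `a` with the cliques
  -- among the neighbours of `a`, that is, with the link of `a`.
  sumS-sublists-filter : ∀ p (L : List A) f →
    sumS (sublists L) (λ G → if allB p G then f G else zeroS) ≋ sumS (sublists (filterT p L)) f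
  sumS-sublists-filter p []      f k = refl
  sumS-sublists-filter p (a ∷ L) f k = trans (trans
    (sumS-++ (sublists L) (map (a ∷_) (sublists L)) _ k)
    (cong₂ ℤ._+_ (sumS-sublists-filter p L f k) (sumS-map (a ∷_) (sublists L) _ k))) containing-a
    where
    containing-a : sumS (sublists (filterT p L)) f k ℤ.+
        sumS (sublists L) (λ G → if p a ∧ allB p G then f (a ∷ G) else zeroS) k
      ≡ sumS (sublists (filterT p (a ∷ L))) f k
    containing-a with p a
    ... | true  = trans
      (cong (ℤ._+_ (sumS (sublists (filterT p L)) f k))
        (trans (sumS-sublists-filter p L (f ∘ (a ∷_)) k) (sym (sumS-map (a ∷_) (sublists (filterT p L)) f k))))
      (sym (sumS-++ (sublists (filterT p L)) (map (a ∷_) (sublists (filterT p L))) f k))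
    ... | false = trans
      (cong (ℤ._+_ (sumS (sublists (filterT p L)) f k)) (sumS-zero (sublists L) (λ _ _ → refl) k))
      (ℤₚ.+-identityʳ _)

  All-sublists : ∀ {P : A → Set} {L} → All P L → All (All P) (sublists L)
  All-sublists []        = [] ∷ []
  All-sublists (pa ∷ pL) = Allₚ.++⁺ (All-sublists pL) (Allₚ.map⁺ (All.map (pa ∷_) (All-sublists pL)))

  AllPairs-sublists : ∀ {R : A → A → Set} {L} → AllPairs R L → All (AllPairs R) (sublists L)
  AllPairs-sublists []        = [] ∷ []
  AllPairs-sublists (ra ∷ rL) = Allₚ.++⁺ (AllPairs-sublists rL)
    (Allₚ.map⁺ (All.zipWith (λ { (x , y) → x ∷ y }) (All-sublists ra , AllPairs-sublists rL)))

module Cliques {A : Set} (adj : A → A → Bool) where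

  isClique : List A → Bool
  isClique G = allB (λ u → allB (λ v → adj u v) G) G

  cliques : List A → List (List A)
  cliques L = filterT isClique (sublists L)

  cliqueSeries : List A → Series
  cliqueSeries L = sumS (cliques L) (λ G → powS X/1-X (length G))

  -- The multisets of size `k` supported on a clique, each written once, in the order of the list. A
  -- chosen `a` stays available for repetition while its non-neighbours disappear; the last branch
  -- gives up `a` for good.
  multicliques : List A → ℕ → List (List A)
  multicliques L       zero    = [] ∷ []
  multicliques []      (suc k) = []
  multicliques (a ∷ L) (suc k) =
    map (a ∷_) (multicliques (a ∷ filterT (adj a) L) k) ++ multicliques L (suc k)

  module _ (adj-refl : ∀ a → adj a a ≡ true) (adj-sym : ∀ a b → adj a b ≡ adj b a) where

    isClique-∷ : ∀ a G → isClique (a ∷ G) ≡ allB (adj a) G ∧ isClique G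
    isClique-∷ a G
      rewrite adj-refl a | allB-∧ (λ u → adj u a) (λ u → allB (adj u) G) G
            | allB-cong (λ u → adj-sym u a) G
      with allB (adj a) G
    ... | true  = refl
    ... | false = refl

    isClique⇒AllPairs : ∀ G → isClique G ≡ true → AllPairs (λ a b → adj a b ≡ true) G
    isClique⇒AllPairs []      e = []
    isClique⇒AllPairs (a ∷ G) e =
      let ea , eG = ∧-true (trans (sym (isClique-∷ a G)) e) in allB⇒All (adj a) G ea ∷ isClique⇒AllPairs G eG

    weight : List A → Series
    weight G = if isClique G then powS X/1-X (length G) else zeroS

    cliqueSeries-weight : ∀ L → cliqueSeries L ≋ sumS (sublists L) weight
    cliqueSeries-weight L k = trans (sumS-filter (λ G → isClique G Boolₚ.≟ true) (sublists L) _ k)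
      (sumS-cong (sublists L)
        (λ G k → cong (λ b → (if b then powS X/1-X (length G) else zeroS) k) (does-≟-true (isClique G))) k)

    weight-∷ : ∀ a G → weight (a ∷ G) ≋ X/1-X ⊛ (if allB (adj a) G then weight G else zeroS)
    weight-∷ a G k rewrite isClique-∷ a G with allB (adj a) G
    ... | false = sym (S.zeroʳ X/1-X k)
    ... | true  with isClique G
    ...   | true  = refl
    ...   | false = sym (S.zeroʳ X/1-X k)

    -- Deletion and link: a clique avoids `a`, or it is `a` together with a clique among the
    -- remaining neighbours of `a`.
    cliqueSeries-∷ : ∀ a L →
      cliqueSeries (a ∷ L) ≋ cliqueSeries L ⊕ (X/1-X ⊛ cliqueSeries (filterT (adj a) L))
    cliqueSeries-∷ a L = S.trans (cliqueSeries-weight (a ∷ L))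
      (S.trans (sumS-++ (sublists L) (map (a ∷_) (sublists L)) weight)
        (S.+-cong (S.sym (cliqueSeries-weight L))
        (S.trans (sumS-map (a ∷_) (sublists L) weight)
        (S.trans (sumS-cong (sublists L) (weight-∷ a))
        (S.trans (S.sym (⊛-sumS X/1-X (sublists L) (λ G → if allB (adj a) G then weight G else zeroS)))
          (S.*-congˡ {X/1-X} (S.trans (sumS-sublists-filter (adj a) L weight)
                               (S.sym (cliqueSeries-weight (filterT (adj a) L))))))))))

    cliqueSeries-multicliques : ∀ k L → cliqueSeries L k ≡ + length (multicliques L k)
    cliqueSeries-multicliques zero []      = refl
    cliqueSeries-multicliques zero (a ∷ L) = trans (cliqueSeries-∷ a L 0)
      (cong₂ ℤ._+_ (cliqueSeries-multicliques zero L) (X/1-X-unfold (cliqueSeries (filterT (adj a) L)) 0))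
    cliqueSeries-multicliques (suc k) []      = refl
    cliqueSeries-multicliques (suc k) (a ∷ L) = begin
      cliqueSeries (a ∷ L) (suc k)
        ≡⟨ cliqueSeries-∷ a L (suc k) ⟩
      cliqueSeries L (suc k) ℤ.+ (X/1-X ⊛ cliqueSeries M) (suc k)
        ≡⟨ cong₂ ℤ._+_ (cliqueSeries-multicliques (suc k) L) repeat-a ⟩
      + length (multicliques L (suc k)) ℤ.+ + length (multicliques (a ∷ M) k)
        ≡⟨ cong +_ (ℕₚ.+-comm (length (multicliques L (suc k))) _) ⟩
      + (length (multicliques (a ∷ M) k) ℕ.+ length (multicliques L (suc k)))
        ≡⟨ cong (λ l → + (l ℕ.+ length (multicliques L (suc k)))) (sym (Listₚ.length-map (a ∷_) (multicliques (a ∷ M) k))) ⟩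
      + (length (map (a ∷_) (multicliques (a ∷ M) k)) ℕ.+ length (multicliques L (suc k)))
        ≡⟨ cong +_ (sym (Listₚ.length-++ (map (a ∷_) (multicliques (a ∷ M) k)))) ⟩
      + length (multicliques (a ∷ L) (suc k)) ∎
      where
      open ≡-Reasoning
      M = filterT (adj a) L
      repeat-a : (X/1-X ⊛ cliqueSeries M) (suc k) ≡ + length (multicliques (a ∷ M) k)
      repeat-a = begin
        (X/1-X ⊛ cliqueSeries M) (suc k)                ≡⟨ X/1-X-unfold (cliqueSeries M) (suc k) ⟩
        cliqueSeries M k ℤ.+ (X/1-X ⊛ cliqueSeries M) k
          -- All members of `M` are adjacent to `a`, so filtering once more changes nothing, and
          -- `cliqueSeries-∷` can be read backwards for `a ∷ M`.
          ≡⟨ cong (λ N → cliqueSeries M k ℤ.+ (X/1-X ⊛ cliqueSeries N) k)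
               (sym (Listₚ.filter-idem (λ b → adj a b Boolₚ.≟ true) L)) ⟩
        cliqueSeries M k ℤ.+ (X/1-X ⊛ cliqueSeries (filterT (adj a) M)) k
          ≡⟨ sym (cliqueSeries-∷ a M k) ⟩
        cliqueSeries (a ∷ M) k                          ≡⟨ cliqueSeries-multicliques k (a ∷ M) ⟩
        + length (multicliques (a ∷ M) k)               ∎

  module Ordered (R : A → A → Set) (R-refl : ∀ {a} → R a a) (R⇒adj : ∀ {a b} → R a b → adj a b ≡ true) where

    -- A list in which all pairs satisfy this never contradicts `R`: no later entry is related to an
    -- earlier one. As `R` is reflexive, such a list has no repetitions.
    Before : A → A → Set
    Before a b = ¬ R b a

    Before⇒Unique : ∀ {L} → AllPairs Before L → Unique L
    Before⇒Unique = AllPairs.map (λ ¬Rba → λ { refl → ¬Rba R-refl })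

    multicliques-sound : ∀ k {L} → AllPairs (λ a b → adj a b ≡ true → R a b) L →
      ∀ {G} → G ∈ multicliques L k → AllPairs R G × All (_∈ L) G × length G ≡ k
    multicliques-sound zero    {L}     o (here refl) = [] , [] , refl
    multicliques-sound (suc k) {a ∷ L} (oa ∷ o) {G} G∈
      with ∈ₚ.∈-++⁻ (map (a ∷_) (multicliques (a ∷ filterT (adj a) L) k)) G∈
    ... | inj₂ G∈′ =
      let R-G , G⊆ , l = multicliques-sound (suc k) o G∈′ in R-G , All.map there G⊆ , l
    ... | inj₁ G∈′ with ∈ₚ.∈-map⁻ (a ∷_) G∈′
    ...   | G′ , G′∈ , refl =
      let R-G , G⊆ , l = multicliques-sound k
            (Allₚ.filter⁺ (λ b → adj a b Boolₚ.≟ true) oa ∷ AllPairsₚ.filter⁺ (λ b → adj a b Boolₚ.≟ true) o) G′∈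
      in All.map above G⊆ ∷ R-G , here refl ∷ All.map weaken G⊆ , cong suc l
      where
      above : ∀ {b} → b ∈ a ∷ filterT (adj a) L → R a b
      above (here refl) = R-refl
      above (there b∈)  = let b∈L , e = ∈ₚ.∈-filter⁻ (λ b → adj a b Boolₚ.≟ true) b∈ in All.lookup oa b∈L e
      weaken : ∀ {b} → b ∈ a ∷ filterT (adj a) L → b ∈ a ∷ L
      weaken (here e)   = here e
      weaken (there b∈) = there (proj₁ (∈ₚ.∈-filter⁻ (λ b → adj a b Boolₚ.≟ true) b∈))

    multicliques-complete : ∀ k {L} → AllPairs Before L →
      ∀ {G} → AllPairs R G → All (_∈ L) G → length G ≡ k → G ∈ multicliques L k
    multicliques-complete zero    o {[]}    rG      G⊆        l = here refl
    multicliques-complete (suc k) {a ∷ L} (oa ∷ o) {b ∷ G} (rb ∷ rG) (here refl ∷ G⊆) l =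
      ∈ₚ.∈-++⁺ˡ (∈ₚ.∈-map⁺ (a ∷_) (multicliques-complete k
        (Allₚ.filter⁺ (λ b → adj a b Boolₚ.≟ true) oa ∷ AllPairsₚ.filter⁺ (λ b → adj a b Boolₚ.≟ true) o) rG
        (All.zipWith (λ { (r , here e) → here e
                        ; (r , there c∈) → there (∈ₚ.∈-filter⁺ (λ b → adj a b Boolₚ.≟ true) c∈ (R⇒adj r)) }) (rb , G⊆))
        (ℕₚ.suc-injective l)))
    multicliques-complete (suc k) {a ∷ L} (oa ∷ o) {b ∷ G} (rb ∷ rG) (there b∈ ∷ G⊆) l =
      ∈ₚ.∈-++⁺ʳ (map (a ∷_) (multicliques (a ∷ filterT (adj a) L) k)) (multicliques-complete (suc k) o (rb ∷ rG)
        -- An occurrence of `a` in `G` would give `R b a`, although `b` comes after `a` in the list.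
        -- So skipping `a` at the head means skipping it altogether.
        (b∈ ∷ All.zipWith (λ { (r , here refl) → contradiction r (All.lookup oa b∈)
                             ; (r , there c∈) → c∈ }) (rb , G⊆)) l)

    -- The two branches are disjoint: lists in the first start with `a`, those in the second with an
    -- entry of `L`, and `a` does not recur in `L`.
    multicliques-unique : ∀ k {L} → AllPairs Before L → Unique (multicliques L k)
    multicliques-unique zero    o = [] ∷ []
    multicliques-unique (suc k) {[]}    o = []
    multicliques-unique (suc k) {a ∷ L} (oa ∷ o) = Uniqueₚ.++⁺
      (Uniqueₚ.map⁺ (λ { refl → refl }) (multicliques-unique k
        (Allₚ.filter⁺ (λ b → adj a b Boolₚ.≟ true) oa ∷ AllPairsₚ.filter⁺ (λ b → adj a b Boolₚ.≟ true) o)))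
      (multicliques-unique (suc k) o)
      disjoint
      where
      heads-in : ∀ k {L} {G} {b} → b ∷ G ∈ multicliques L (suc k) → b ∈ L
      heads-in k {a ∷ L} bG∈ with ∈ₚ.∈-++⁻ (map (a ∷_) (multicliques (a ∷ filterT (adj a) L) k)) bG∈
      ... | inj₂ bG∈′ = there (heads-in k bG∈′)
      ... | inj₁ bG∈′ with ∈ₚ.∈-map⁻ (a ∷_) bG∈′
      ...   | _ , _ , refl = here refl
      disjoint : ∀ {G} → G ∈ map (a ∷_) (multicliques (a ∷ filterT (adj a) L) k) × G ∈ multicliques L (suc k) → _
      disjoint (G∈ , G∈′) with ∈ₚ.∈-map⁻ (a ∷_) G∈
      ... | _ , _ , refl = All.lookup oa (heads-in k G∈′) R-refl

-- Prefix sums and the orientation of the edges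

prefixSums : ∀ {n} → ℕ → Vec ℕ n → Vec ℕ n
prefixSums c []       = []
prefixSums c (a ∷ as) = (c ℕ.+ a) ∷ prefixSums (c ℕ.+ a) as

prefixSums-injective : ∀ {n} c {u v : Vec ℕ n} → prefixSums c u ≡ prefixSums c v → u ≡ v
prefixSums-injective c {[]}    {[]}    e = refl
prefixSums-injective c {a ∷ u} {b ∷ v} e with ℕₚ.+-cancelˡ-≡ c a b (proj₁ (Vecₚ.∷-injective e))
... | refl = cong (a ∷_) (prefixSums-injective (c ℕ.+ a) (proj₂ (Vecₚ.∷-injective e)))

infix 4 _⋖_
_⋖_ : ℕ → ℕ → Set
a ⋖ b = a ≤ b × b ≤ suc a

-- One orientation of compatibility, ι(v) - ι(u) ∈ {0,1}^n, expressed over ℕ.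
Interleaved : ∀ {n} → Vec ℕ n → Vec ℕ n → Set
Interleaved u v = Pointwise _⋖_ (prefixSums 0 u) (prefixSums 0 v)

⋖-refl : ∀ {a} → a ⋖ a
⋖-refl = ℕₚ.≤-refl , ℕₚ.n≤1+n _

Interleaved-refl : ∀ {n} {u : Vec ℕ n} → Interleaved u u
Interleaved-refl = Pointwise.refl ⋖-refl

ιaux-prefixSums : ∀ {n} c (u : Vec ℕ n) → ιaux (+ c) u ≡ Vec.map +_ (prefixSums c u)
ιaux-prefixSums c []      = refl
ιaux-prefixSums c (a ∷ u) = cong (+ (c ℕ.+ a) ∷_) (ιaux-prefixSums (c ℕ.+ a) u)

isBit⇒⋖ : ∀ a b → isBit (+ b ℤ.- + a) ≡ true → a ⋖ b
isBit⇒⋖ a b e with a ℕ.≤? b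
... | yes a≤b = a≤b , bound (b ∸ a) (ℕₚ.m∸n+n≡m a≤b) (subst (λ z → isBit z ≡ true) (trans (ℤₚ.m-n≡m⊖n b a) (ℤₚ.⊖-≥ a≤b)) e)
  where
  bound : ∀ d → d ℕ.+ a ≡ b → isBit (+ d) ≡ true → b ≤ suc a
  bound zero       refl _ = ℕₚ.n≤1+n a
  bound (suc zero) refl _ = ℕₚ.≤-refl
... | no a≰b = contradiction
  (subst (λ z → isBit z ≡ true) (trans (ℤₚ.m-n≡m⊖n b a) (ℤₚ.⊖-< (ℕₚ.≰⇒> a≰b))) e)
  (negative (a ∸ b) (ℕₚ.m<n⇒0<n∸m (ℕₚ.≰⇒> a≰b)))
  where
  negative : ∀ d → 0 < d → ¬ isBit (ℤ.- (+ d)) ≡ true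
  negative (suc d) _ ()

⋖⇒isBit : ∀ {a b} → a ⋖ b → isBit (+ b ℤ.- + a) ≡ true
⋖⇒isBit {a} {b} (a≤b , b≤1+a) = subst (λ z → isBit z ≡ true) (sym (trans (ℤₚ.m-n≡m⊖n b a) (ℤₚ.⊖-≥ a≤b)))
  (bit (ℕₚ.≤-trans (ℕₚ.∸-monoˡ-≤ a b≤1+a) (ℕₚ.≤-reflexive (ℕₚ.m+n∸n≡m 1 a))))
  where
  bit : ∀ {d} → d ≤ 1 → isBit (+ d) ≡ true
  bit z≤n       = refl
  bit (s≤s z≤n) = refl

diff01⇒⋖ : ∀ {n} (p q : Vec ℕ n) → diff01 (Vec.map +_ q) (Vec.map +_ p) ≡ true → Pointwise _⋖_ p q
diff01⇒⋖ []      []      e = []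
diff01⇒⋖ (a ∷ p) (b ∷ q) e = let ea , ep = ∧-true e in isBit⇒⋖ a b ea ∷ diff01⇒⋖ p q ep

⋖⇒diff01 : ∀ {n} {p q : Vec ℕ n} → Pointwise _⋖_ p q → diff01 (Vec.map +_ q) (Vec.map +_ p) ≡ true
⋖⇒diff01 []       = refl
⋖⇒diff01 (r ∷ rs) = cong₂ _∧_ (⋖⇒isBit r) (⋖⇒diff01 rs)

Interleaved⇒diff01 : ∀ {n} {u v : Vec ℕ n} → Interleaved u v → diff01 (ι v) (ι u) ≡ true
Interleaved⇒diff01 {u = u} {v} r = trans (cong₂ diff01 (ιaux-prefixSums 0 v) (ιaux-prefixSums 0 u)) (⋖⇒diff01 r)

diff01⇒Interleaved : ∀ {n} {u v : Vec ℕ n} → diff01 (ι v) (ι u) ≡ true → Interleaved u v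
diff01⇒Interleaved {u = u} {v} e =
  diff01⇒⋖ _ _ (trans (sym (cong₂ diff01 (ιaux-prefixSums 0 v) (ιaux-prefixSums 0 u))) e)

compat-sym : ∀ {n} (u v : Vec ℕ n) → compat u v ≡ compat v u
compat-sym u v = Boolₚ.∨-comm (diff01 (ι u) (ι v)) (diff01 (ι v) (ι u))

Interleaved⇒compat : ∀ {n} {u v : Vec ℕ n} → Interleaved u v → compat u v ≡ true
Interleaved⇒compat {u = u} {v} r =
  trans (cong (diff01 (ι u) (ι v) ∨_) (Interleaved⇒diff01 r)) (Boolₚ.∨-zeroʳ _)

compat-refl : ∀ {n} (u : Vec ℕ n) → compat u u ≡ true
compat-refl u = Interleaved⇒compat (Interleaved-refl {u = u})

compat⇒Interleaved : ∀ {n} {u v : Vec ℕ n} → ¬ Interleaved v u → compat u v ≡ true → Interleaved u v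
compat⇒Interleaved {u = u} {v} ¬r e with diff01 (ι u) (ι v) in eq
... | true  = contradiction (diff01⇒Interleaved eq) ¬r
... | false = diff01⇒Interleaved e

-- The initial value `c` is arbitrary so that the relation survives when both vectors are extended
-- by the same first entry, which only shifts `c`.
NotAbove : ∀ {n} → Vec ℕ n → Vec ℕ n → Set
NotAbove u v = ∀ c → ¬ Pointwise _≤_ (prefixSums c v) (prefixSums c u)

-- `allVecs` runs through the vectors lexicographically. At the first coordinate where two of them
-- differ, the later one has the larger prefix sum, so it cannot lie below the earlier one.
allVecs-ordered : ∀ n {xs} → AllPairs _<_ xs → AllPairs NotAbove (allVecs n xs)
allVecs-ordered zero    o = [] ∷ []
allVecs-ordered (suc n) {xs} o = AllPairsₚ.concat⁺
  (Allₚ.map⁺ (All.universal (λ x → AllPairsₚ.map⁺ (AllPairs.map (λ {u} {v} → same x {u} {v}) (allVecs-ordered n o))) xs))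
  (AllPairsₚ.map⁺ (AllPairs.map (λ x<y → Allₚ.map⁺ (All.universal (λ u →
     Allₚ.map⁺ (All.universal (λ v → different {u = u} {v} x<y) (allVecs n xs))) (allVecs n xs))) o))
  where
  same : ∀ x {u v : Vec ℕ n} → NotAbove u v → NotAbove (x ∷ u) (x ∷ v)
  same x ¬b c (_ ∷ b) = ¬b (c ℕ.+ x) b
  different : ∀ {x y} {u v : Vec ℕ n} → x < y → NotAbove (x ∷ u) (y ∷ v)
  different x<y c (b ∷ _) = ℕₚ.<⇒≱ x<y (ℕₚ.+-cancelˡ-≤ c _ _ b)

Ω-ordered : ∀ n r → AllPairs (λ u v → ¬ Interleaved v u) (Ω n r)
Ω-ordered n r = AllPairs.map (λ ¬b r → ¬b 0 (Pointwise.map proj₁ r))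
  (AllPairsₚ.filter⁺ (λ u → sumV u ℕ.≟ r)
    (allVecs-ordered n (AllPairsₚ.applyUpTo⁺₁ id (suc r) (λ i<j _ → i<j))))

allVecs-∈ : ∀ {n N} (u : Vec ℕ n) → sumV u ≤ N → u ∈ allVecs n (upTo (suc N))
allVecs-∈ []      _  = here refl
allVecs-∈ {suc n} {N} (a ∷ u) le = ∈ₚ.∈-concat⁺′
  (∈ₚ.∈-map⁺ (a ∷_) (allVecs-∈ u (ℕₚ.≤-trans (ℕₚ.m≤n+m (sumV u) a) le)))
  (∈ₚ.∈-map⁺ (λ x → map (x ∷_) (allVecs n (upTo (suc N)))) (∈ₚ.∈-upTo⁺ (s≤s (ℕₚ.≤-trans (ℕₚ.m≤m+n a (sumV u)) le))))

∈-Ω⁺ : ∀ {n r} {u : Vec ℕ n} → sumV u ≡ r → u ∈ Ω n r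
∈-Ω⁺ {r = r} {u} e = ∈ₚ.∈-filter⁺ (λ u → sumV u ℕ.≟ r) (allVecs-∈ u (ℕₚ.≤-reflexive e)) e

∈-Ω⁻ : ∀ {n r} {u : Vec ℕ n} → u ∈ Ω n r → sumV u ≡ r
∈-Ω⁻ {n} {r} u∈ = proj₂ (∈ₚ.∈-filter⁻ (λ u → sumV u ℕ.≟ r) {xs = allVecs n (upTo (suc r))} u∈)

-- Dimension bound: along a chain the sum of the prefix sums increases strictly, by at most n − 1 in total
-- because the last prefix sum is constant.

⋖-sum : ∀ {n} {p q : Vec ℕ n} → Pointwise _⋖_ p q → Vec.sum p ≤ Vec.sum q
⋖-sum []               = z≤n
⋖-sum ((a≤b , _) ∷ rs) = ℕₚ.+-mono-≤ a≤b (⋖-sum rs)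

⋖-sum-< : ∀ {n} {p q : Vec ℕ n} → Pointwise _⋖_ p q → ¬ Pointwise _⋖_ q p → Vec.sum p < Vec.sum q
⋖-sum-< []                     ¬r = contradiction [] ¬r
⋖-sum-< {p = a ∷ p} {b ∷ q} ((a≤b , b≤) ∷ rs) ¬r with a ℕ.≟ b
... | yes refl = ℕₚ.+-monoʳ-< a (⋖-sum-< rs (λ r → ¬r (⋖-refl ∷ r)))
... | no a≢b   = ℕₚ.+-mono-<-≤ (ℕₚ.≤∧≢⇒< a≤b a≢b) (⋖-sum rs)

⋖-sum-≤ : ∀ {m} c c′ (u v : Vec ℕ (suc m)) → c ℕ.+ sumV u ≡ c′ ℕ.+ sumV v →
  Pointwise _⋖_ (prefixSums c u) (prefixSums c′ v) → Vec.sum (prefixSums c′ v) ≤ Vec.sum (prefixSums c u) ℕ.+ m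
-- The last prefix sums are the two totals, equal by `e`: the final coordinate adds nothing, which
-- leaves `m` increments for `suc m` coordinates.
⋖-sum-≤ {zero} c c′ (a ∷ []) (b ∷ []) e (_ ∷ []) rewrite ℕₚ.+-identityʳ a | ℕₚ.+-identityʳ b | e =
  ℕₚ.m≤m+n _ 0
⋖-sum-≤ {suc m} c c′ (a ∷ u) (b ∷ v) e ((_ , le) ∷ rs) = begin
  c′ ℕ.+ b ℕ.+ Vec.sum (prefixSums (c′ ℕ.+ b) v)
    ≤⟨ ℕₚ.+-mono-≤ le (⋖-sum-≤ (c ℕ.+ a) (c′ ℕ.+ b) u v
         (trans (ℕₚ.+-assoc c a _) (trans e (sym (ℕₚ.+-assoc c′ b _)))) rs) ⟩
  suc (c ℕ.+ a) ℕ.+ (Vec.sum (prefixSums (c ℕ.+ a) u) ℕ.+ m)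
    ≡⟨ cong suc (sym (ℕₚ.+-assoc (c ℕ.+ a) _ m)) ⟩
  suc (c ℕ.+ a ℕ.+ Vec.sum (prefixSums (c ℕ.+ a) u) ℕ.+ m)
    ≡⟨ sym (ℕₚ.+-suc _ m) ⟩
  c ℕ.+ a ℕ.+ Vec.sum (prefixSums (c ℕ.+ a) u) ℕ.+ suc m ∎
  where open ℕₚ.≤-Reasoning

StrictlyInterleaved : ∀ {n} → Vec ℕ n → Vec ℕ n → Set
StrictlyInterleaved u v = Interleaved u v × ¬ Interleaved v u

prefixTotal : ∀ {n} → Vec ℕ n → ℕ
prefixTotal u = Vec.sum (prefixSums 0 u)

chain-length : ∀ {n} M (u : Vec ℕ n) G → AllPairs StrictlyInterleaved (u ∷ G) →
  All (λ v → prefixTotal v ≤ M) (u ∷ G) → prefixTotal u ℕ.+ length G ≤ M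
chain-length M u []      _                      (b ∷ []) = subst (_≤ M) (sym (ℕₚ.+-identityʳ _)) b
chain-length M u (v ∷ G) (((r , ¬r) ∷ _) ∷ rs)  (_ ∷ bs) = begin
  prefixTotal u ℕ.+ suc (length G)  ≡⟨ ℕₚ.+-suc _ _ ⟩
  suc (prefixTotal u) ℕ.+ length G  ≤⟨ ℕₚ.+-monoˡ-≤ (length G) (⋖-sum-< r ¬r) ⟩
  prefixTotal v ℕ.+ length G        ≤⟨ chain-length M v G rs bs ⟩
  M ∎
  where open ℕₚ.≤-Reasoning

strict-chain-length : ∀ {n r} → 1 ≤ r → (G : List (Vec ℕ n)) →
  AllPairs StrictlyInterleaved G → All (λ u → sumV u ≡ r) G → length G ≤ n
strict-chain-length 1≤r []       rs es = z≤n
strict-chain-length {zero}  1≤r ([] ∷ G) rs (refl ∷ es) = contradiction 1≤r λ ()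
strict-chain-length {suc m} 1≤r (u ∷ G) (ru ∷ rs) (eu ∷ es) = s≤s (ℕₚ.+-cancelˡ-≤ (prefixTotal u) _ _
  (chain-length (prefixTotal u ℕ.+ m) u G (ru ∷ rs)
    (ℕₚ.m≤m+n _ m ∷ All.zipWith (λ { {v} ((r , _) , ev) → ⋖-sum-≤ 0 0 u v (trans eu (sym ev)) r }) (ru , es))))

-- A chain is determined by its total

module ℕ+ = CommutativeSemigroupProperties ℕₚ.+-commutativeSemigroup

total : ∀ {n} → List (Vec ℕ n) → Vec ℕ n
total = List.foldr (Vec.zipWith ℕ._+_) (Vec.replicate _ 0)

sumV-zipWith-+ : ∀ {n} (u v : Vec ℕ n) → sumV (Vec.zipWith ℕ._+_ u v) ≡ sumV u ℕ.+ sumV v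
sumV-zipWith-+ []      []      = refl
sumV-zipWith-+ (a ∷ u) (b ∷ v) = trans (cong (a ℕ.+ b ℕ.+_) (sumV-zipWith-+ u v)) (ℕ+.interchange a b (sumV u) (sumV v))

sumV-replicate-0 : ∀ n → sumV (Vec.replicate n 0) ≡ 0
sumV-replicate-0 zero    = refl
sumV-replicate-0 (suc n) = sumV-replicate-0 n

sumV-total : ∀ {n r} (G : List (Vec ℕ n)) → All (λ u → sumV u ≡ r) G → sumV (total G) ≡ r ℕ.* length G
sumV-total {n} {r} []      []       = trans (sumV-replicate-0 n) (sym (ℕₚ.*-zeroʳ r))
sumV-total {n} {r} (u ∷ G) (e ∷ es) = trans (sumV-zipWith-+ u (total G))
  (trans (cong₂ ℕ._+_ e (sumV-total G es)) (sym (ℕₚ.*-suc r (length G))))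

prefixSums-replicate-0 : ∀ n → prefixSums 0 (Vec.replicate n 0) ≡ Vec.replicate n 0
prefixSums-replicate-0 zero    = refl
prefixSums-replicate-0 (suc n) = cong (0 ∷_) (prefixSums-replicate-0 n)

prefixSums-zipWith-+ : ∀ {n} c d (u v : Vec ℕ n) → prefixSums (c ℕ.+ d) (Vec.zipWith ℕ._+_ u v) ≡
  Vec.zipWith ℕ._+_ (prefixSums c u) (prefixSums d v)
prefixSums-zipWith-+ c d []      []      = refl
prefixSums-zipWith-+ c d (a ∷ u) (b ∷ v) rewrite ℕ+.interchange c d a b =
  cong (c ℕ.+ a ℕ.+ (d ℕ.+ b) ∷_) (prefixSums-zipWith-+ (c ℕ.+ a) (d ℕ.+ b) u v)

-- Says q = ⌊t / (l + 1)⌋ by inequalities, a form that can be obtained by adding bounds along a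
-- chain.
Quotient : ℕ → ℕ → ℕ → Set
Quotient l q t = suc l ℕ.* q ≤ t × t < suc l ℕ.* suc q

Quotient-unique : ∀ {l q q′ t} → Quotient l q t → Quotient l q′ t → q ≡ q′
Quotient-unique {l} (lo , hi) (lo′ , hi′) = ℕₚ.≤-antisym (below lo hi′) (below lo′ hi)
  where
  below : ∀ {q q′ t} → suc l ℕ.* q ≤ t → t < suc l ℕ.* suc q′ → q ≤ q′
  below lo hi = ℕₚ.≤-pred (ℕₚ.*-cancelˡ-< (suc l) _ _ (ℕₚ.≤-<-trans lo hi))

chain-total : ∀ {n} {u : Vec ℕ n} G → All (Interleaved u) G →
  Pointwise (λ q t → length G ℕ.* q ≤ t × t ≤ length G ℕ.* suc q) (prefixSums 0 u) (prefixSums 0 (total G))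
chain-total {n} {u} [] [] rewrite prefixSums-replicate-0 n = zeros (prefixSums 0 u)
  where
  zeros : ∀ {n} (p : Vec ℕ n) → Pointwise (λ q t → 0 ≤ t × t ≤ 0) p (Vec.replicate n 0)
  zeros []      = []
  zeros (a ∷ p) = (z≤n , z≤n) ∷ zeros p
chain-total {n} {u} (v ∷ G) (r ∷ rs) rewrite prefixSums-zipWith-+ 0 0 v (total G) = add r (chain-total G rs)
  where
  l = length G
  add : ∀ {n} {p q t : Vec ℕ n} → Pointwise _⋖_ p q → Pointwise (λ q t → l ℕ.* q ≤ t × t ≤ l ℕ.* suc q) p t →
    Pointwise (λ q t → suc l ℕ.* q ≤ t × t ≤ suc l ℕ.* suc q) p (Vec.zipWith ℕ._+_ q t)
  add {p = []} {[]} {[]} [] [] = []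
  add {p = _ ∷ _} {_ ∷ _} {_ ∷ _} ((x , y) ∷ rs) ((z , w) ∷ bs) = (ℕₚ.+-mono-≤ x z , ℕₚ.+-mono-≤ y w) ∷ add rs bs

-- Over the head's prefix sum, the head itself has excess 0 and each of the other vertices excess at
-- most 1. The total excess is at most `length G`, hence smaller than the number of vertices.
chain-head : ∀ {n} {u : Vec ℕ n} G → All (Interleaved u) G →
  Pointwise (Quotient (length G)) (prefixSums 0 u) (prefixSums 0 (total (u ∷ G)))
chain-head {n} {u} G rs rewrite prefixSums-zipWith-+ 0 0 u (total G) = add (chain-total G rs)
  where
  l = length G
  add : ∀ {n} {p t : Vec ℕ n} → Pointwise (λ q t → l ℕ.* q ≤ t × t ≤ l ℕ.* suc q) p t →
    Pointwise (Quotient l) p (Vec.zipWith ℕ._+_ p t)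
  add {p = []} {[]} [] = []
  add {p = a ∷ _} {_ ∷ _} ((z , w) ∷ bs) = (ℕₚ.+-monoʳ-≤ a z , s≤s (ℕₚ.+-monoʳ-≤ a w)) ∷ add bs

zipWith-+-cancelˡ : ∀ {n} (u : Vec ℕ n) {v w} → Vec.zipWith ℕ._+_ u v ≡ Vec.zipWith ℕ._+_ u w → v ≡ w
zipWith-+-cancelˡ []      {[]}    {[]}    e = refl
zipWith-+-cancelˡ (a ∷ u) {b ∷ v} {c ∷ w} e = cong₂ _∷_
  (ℕₚ.+-cancelˡ-≡ a b c (proj₁ (Vecₚ.∷-injective e))) (zipWith-+-cancelˡ u (proj₂ (Vecₚ.∷-injective e)))

-- The prefix sums of the head are the quotients of those of the total by the length. Once the head
-- is known, cancelling it leaves the total of the rest of the chain.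
total-injective : ∀ {n} {G H : List (Vec ℕ n)} → AllPairs Interleaved G → AllPairs Interleaved H →
  length G ≡ length H → total G ≡ total H → G ≡ H
total-injective {G = []}    {[]}    _        _        _  _ = refl
total-injective {G = u ∷ G} {v ∷ H} (ru ∷ rG) (rv ∷ rH) le te
  with prefixSums-injective 0 {u} {v} (heads {l = length G} (chain-head G ru)
         (subst₂ (λ l w → Pointwise (Quotient l) (prefixSums 0 v) (prefixSums 0 w))
           (sym (ℕₚ.suc-injective le)) (sym te) (chain-head H rv)))
  where
  heads : ∀ {n l} {p q t : Vec ℕ n} → Pointwise (Quotient l) p t → Pointwise (Quotient l) q t → p ≡ q
  heads []         []         = refl
  heads {l = l} (_∷_ {y = y} a as) (b ∷ bs) = cong₂ _∷_ (Quotient-unique {l} {t = y} a b) (heads {l = l} as bs)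
... | refl = cong (u ∷_) (total-injective rG rH (ℕₚ.suc-injective le) (zipWith-+-cancelˡ u te))

-- Every vector of coordinate sum r k is the total of a chain

sum-applyUpTo-∷ʳ : ∀ m f → sum (applyUpTo f (suc m)) ≡ sum (applyUpTo f m) ℕ.+ f m
sum-applyUpTo-∷ʳ zero    f = ℕₚ.+-identityʳ (f 0)
sum-applyUpTo-∷ʳ (suc m) f = trans (cong (f 0 ℕ.+_) (sum-applyUpTo-∷ʳ m (f ∘ suc)))
  (sym (ℕₚ.+-assoc (f 0) _ _))

sum-applyUpTo-cong : ∀ m {f g : ℕ → ℕ} → (∀ {i} → i < m → f i ≡ g i) → sum (applyUpTo f m) ≡ sum (applyUpTo g m)
sum-applyUpTo-cong zero    e = refl
sum-applyUpTo-cong (suc m) e = cong₂ ℕ._+_ (e (s≤s z≤n)) (sum-applyUpTo-cong m (λ i<m → e (s≤s i<m)))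

sum-applyUpTo-0 : ∀ m → sum (applyUpTo (λ _ → 0) m) ≡ 0
sum-applyUpTo-0 zero    = refl
sum-applyUpTo-0 (suc m) = sum-applyUpTo-0 m

total-applyUpTo-∷ : ∀ {n} (f : ℕ → ℕ) (g : ℕ → Vec ℕ n) m →
  total (applyUpTo (λ i → f i ∷ g i) m) ≡ sum (applyUpTo f m) ∷ total (applyUpTo g m)
total-applyUpTo-∷ f g zero    = refl
total-applyUpTo-∷ f g (suc m) = cong (Vec.zipWith ℕ._+_ (f 0 ∷ g 0)) (total-applyUpTo-∷ (f ∘ suc) (g ∘ suc) m)

sum-applyUpTo-∸ : ∀ m {f g : ℕ → ℕ} → (∀ i → f i ≤ g i) →
  sum (applyUpTo f m) ℕ.+ sum (applyUpTo (λ i → g i ∸ f i) m) ≡ sum (applyUpTo g m)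
sum-applyUpTo-∸ zero    f≤g = refl
sum-applyUpTo-∸ (suc m) {f} {g} f≤g = trans
  (ℕ+.interchange (f 0) _ _ _)
  (cong₂ ℕ._+_ (ℕₚ.m+[n∸m]≡n (f≤g 0)) (sum-applyUpTo-∸ m (f≤g ∘ suc)))

module _ (k : ℕ) .{{_ : ℕ.NonZero k}} where

  +k-/k : ∀ y → (y ℕ.+ k) ℕ./ k ≡ suc (y ℕ./ k)
  +k-/k y = trans (ℕₚ.+-distrib-/-∣ʳ y ℕ∣.∣-refl) (trans (cong (y ℕ./ k ℕ.+_) (ℕₚ.n/n≡1 k)) (ℕₚ.+-comm _ 1))

  -- Hermite's identity
  sum-quotients : ∀ c → sum (applyUpTo (λ m → (c ℕ.+ m) ℕ./ k) k) ≡ c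
  sum-quotients zero    = trans (sum-applyUpTo-cong k ℕₚ.m<n⇒m/n≡0) (sum-applyUpTo-0 k)
  -- Passing from `c` to `suc c` drops the first term ⌊c/k⌋ and appends ⌊(c + k)/k⌋ = ⌊c/k⌋ + 1, so
  -- the sum grows by one. The dropped term is added to both sides to avoid subtraction.
  sum-quotients (suc c) = ℕₚ.+-cancelˡ-≡ ((c ℕ.+ 0) ℕ./ k) _ _ (begin
    (c ℕ.+ 0) ℕ./ k ℕ.+ sum (applyUpTo (λ m → (suc c ℕ.+ m) ℕ./ k) k)
      ≡⟨ cong ((c ℕ.+ 0) ℕ./ k ℕ.+_) (sum-applyUpTo-cong k (λ {i} _ → cong (ℕ._/ k) (sym (ℕₚ.+-suc c i)))) ⟩
    sum (applyUpTo (λ m → (c ℕ.+ m) ℕ./ k) (suc k))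
      ≡⟨ sum-applyUpTo-∷ʳ k (λ m → (c ℕ.+ m) ℕ./ k) ⟩
    sum (applyUpTo (λ m → (c ℕ.+ m) ℕ./ k) k) ℕ.+ (c ℕ.+ k) ℕ./ k
      ≡⟨ cong₂ ℕ._+_ (sum-quotients c) (+k-/k c) ⟩
    c ℕ.+ suc (c ℕ./ k)
      ≡⟨ trans (ℕₚ.+-suc c _) (ℕₚ.+-comm (suc c) _) ⟩
    c ℕ./ k ℕ.+ suc c
      ≡⟨ cong (λ z → z ℕ./ k ℕ.+ suc c) (sym (ℕₚ.+-identityʳ c)) ⟩
    (c ℕ.+ 0) ℕ./ k ℕ.+ suc c ∎)
    where open ≡-Reasoning

  -- quotientVertex 0 m u is the m-th vertex (m < k) of the chain with total u: its prefix sums are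
  -- ⌊(c + m) / k⌋, c running over the prefix sums of u.
  quotientVertex : ∀ {n} → ℕ → ℕ → Vec ℕ n → Vec ℕ n
  quotientVertex c m []      = []
  quotientVertex c m (a ∷ u) = ((c ℕ.+ a ℕ.+ m) ℕ./ k ∸ (c ℕ.+ m) ℕ./ k) ∷ quotientVertex (c ℕ.+ a) m u

  quotient-mono : ∀ c a m → (c ℕ.+ m) ℕ./ k ≤ (c ℕ.+ a ℕ.+ m) ℕ./ k
  quotient-mono c a m = ℕₚ./-monoˡ-≤ k (ℕₚ.+-monoˡ-≤ m (ℕₚ.m≤m+n c a))

  -- The entries are consecutive differences of quotients and telescope; by `quotient-mono` no
  -- subtraction is truncated.
  prefixSums-quotientVertex : ∀ {n} c m (u : Vec ℕ n) →
    prefixSums ((c ℕ.+ m) ℕ./ k) (quotientVertex c m u) ≡ Vec.map (λ x → (x ℕ.+ m) ℕ./ k) (prefixSums c u)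
  prefixSums-quotientVertex c m []      = refl
  prefixSums-quotientVertex c m (a ∷ u) rewrite ℕₚ.m+[n∸m]≡n (quotient-mono c a m) =
    cong (_ ∷_) (prefixSums-quotientVertex (c ℕ.+ a) m u)

  sumV-quotientVertex : ∀ {n} c m (u : Vec ℕ n) →
    (c ℕ.+ m) ℕ./ k ℕ.+ sumV (quotientVertex c m u) ≡ (c ℕ.+ sumV u ℕ.+ m) ℕ./ k
  sumV-quotientVertex c m []      = trans (ℕₚ.+-identityʳ _) (cong (λ z → (z ℕ.+ m) ℕ./ k) (sym (ℕₚ.+-identityʳ c)))
  sumV-quotientVertex c m (a ∷ u) = begin
    (c ℕ.+ m) ℕ./ k ℕ.+ ((c ℕ.+ a ℕ.+ m) ℕ./ k ∸ (c ℕ.+ m) ℕ./ k ℕ.+ sumV (quotientVertex (c ℕ.+ a) m u))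
      ≡⟨ sym (ℕₚ.+-assoc ((c ℕ.+ m) ℕ./ k) _ _) ⟩
    (c ℕ.+ m) ℕ./ k ℕ.+ ((c ℕ.+ a ℕ.+ m) ℕ./ k ∸ (c ℕ.+ m) ℕ./ k) ℕ.+ sumV (quotientVertex (c ℕ.+ a) m u)
      ≡⟨ cong (ℕ._+ sumV (quotientVertex (c ℕ.+ a) m u)) (ℕₚ.m+[n∸m]≡n (quotient-mono c a m)) ⟩
    (c ℕ.+ a ℕ.+ m) ℕ./ k ℕ.+ sumV (quotientVertex (c ℕ.+ a) m u)
      ≡⟨ sumV-quotientVertex (c ℕ.+ a) m u ⟩
    (c ℕ.+ a ℕ.+ sumV u ℕ.+ m) ℕ./ k
      ≡⟨ cong (λ z → (z ℕ.+ m) ℕ./ k) (ℕₚ.+-assoc c a (sumV u)) ⟩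
    (c ℕ.+ (a ℕ.+ sumV u) ℕ.+ m) ℕ./ k ∎
    where open ≡-Reasoning

  quotientVertex-∈Ω : ∀ {n r m} (u : Vec ℕ n) → m < k → sumV u ≡ r ℕ.* k → sumV (quotientVertex 0 m u) ≡ r
  quotientVertex-∈Ω {r = r} {m} u m<k e = begin
    sumV (quotientVertex 0 m u)                 ≡⟨ cong (ℕ._+ sumV (quotientVertex 0 m u)) (sym (ℕₚ.m<n⇒m/n≡0 m<k)) ⟩
    m ℕ./ k ℕ.+ sumV (quotientVertex 0 m u)     ≡⟨ sumV-quotientVertex 0 m u ⟩
    (sumV u ℕ.+ m) ℕ./ k                        ≡⟨ cong (λ z → (z ℕ.+ m) ℕ./ k) e ⟩
    (r ℕ.* k ℕ.+ m) ℕ./ k                       ≡⟨ ℕₚ.+-distrib-/-∣ˡ m (ℕ∣.n∣m*n r) ⟩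
    r ℕ.* k ℕ./ k ℕ.+ m ℕ./ k                   ≡⟨ cong₂ ℕ._+_ (ℕₚ.m*n/n≡m r k) (ℕₚ.m<n⇒m/n≡0 m<k) ⟩
    r ℕ.+ 0                                     ≡⟨ ℕₚ.+-identityʳ r ⟩
    r                                           ∎
    where open ≡-Reasoning

  -- For i < j < k the numerators x + i and x + j differ by less than k, so their quotients by k
  -- differ by 0 or 1.
  quotientVertex-interleaved : ∀ {n i j} (u : Vec ℕ n) → i < j → j < k →
    Interleaved (quotientVertex 0 i u) (quotientVertex 0 j u)
  quotientVertex-interleaved {i = i} {j} u i<j j<k =
    subst₂ (Pointwise _⋖_) (sym (prefixes (ℕₚ.<-trans i<j j<k))) (sym (prefixes j<k))
      (Pointwise.map⁺ (λ { {x} refl → between x }) (Pointwise.refl {_∼_ = _≡_} refl))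
    where
    prefixes : ∀ {m} → m < k →
      prefixSums 0 (quotientVertex 0 m u) ≡ Vec.map (λ x → (x ℕ.+ m) ℕ./ k) (prefixSums 0 u)
    prefixes {m} m<k = subst (λ c → prefixSums c (quotientVertex 0 m u) ≡ Vec.map (λ x → (x ℕ.+ m) ℕ./ k) (prefixSums 0 u))
      (ℕₚ.m<n⇒m/n≡0 m<k) (prefixSums-quotientVertex 0 m u)
    between : ∀ x → (x ℕ.+ i) ℕ./ k ⋖ (x ℕ.+ j) ℕ./ k
    between x = ℕₚ./-monoˡ-≤ k (ℕₚ.+-monoʳ-≤ x (ℕₚ.<⇒≤ i<j)) ,
      ℕₚ.≤-trans (ℕₚ./-monoˡ-≤ k (ℕₚ.+-mono-≤ (ℕₚ.m≤m+n x i) (ℕₚ.<⇒≤ j<k))) (ℕₚ.≤-reflexive (+k-/k (x ℕ.+ i)))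

  -- In each coordinate the total is a difference of two sums of quotients, which Hermite's identity
  -- evaluates as (c + a) - c.
  total-quotientVertices : ∀ {n} c (u : Vec ℕ n) → total (applyUpTo (λ m → quotientVertex c m u) k) ≡ u
  total-quotientVertices c []      = total-[] (applyUpTo (λ _ → []) k)
    where
    total-[] : (G : List (Vec ℕ 0)) → total G ≡ []
    total-[] G with total G
    ... | [] = refl
  total-quotientVertices c (a ∷ u) = trans
    (total-applyUpTo-∷ _ (λ m → quotientVertex (c ℕ.+ a) m u) k)
    (cong₂ _∷_ (ℕₚ.+-cancelˡ-≡ c _ a (begin
        c ℕ.+ D                                                 ≡⟨ cong (ℕ._+ D) (sym (sum-quotients c)) ⟩
        sum (applyUpTo (λ m → (c ℕ.+ m) ℕ./ k) k) ℕ.+ D         ≡⟨ sum-applyUpTo-∸ k (quotient-mono c a) ⟩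
        sum (applyUpTo (λ m → (c ℕ.+ a ℕ.+ m) ℕ./ k) k)         ≡⟨ sum-quotients (c ℕ.+ a) ⟩
        c ℕ.+ a                                                 ∎))
      (total-quotientVertices (c ℕ.+ a) u))
    where
    open ≡-Reasoning
    D = sum (applyUpTo (λ m → (c ℕ.+ a ℕ.+ m) ℕ./ k ∸ (c ℕ.+ m) ℕ./ k) k)

-- The clique series of the edgewise subdivision

module _ {n : ℕ} where
  open Cliques (compat {n}) public
  open Ordered Interleaved Interleaved-refl Interleaved⇒compat public

AllPairs-relativise : ∀ {A : Set} {P : A → Set} {R Q : A → A → Set} {L} →
  (∀ {a b} → P a → P b → R a b → Q a b) → All P L → AllPairs R L → AllPairs Q L
AllPairs-relativise f []       []         = []
AllPairs-relativise f (p ∷ ps) (rs ∷ rss) =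
  All.zipWith (λ { (p′ , r) → f p p′ r }) (ps , rs) ∷ AllPairs-relativise f ps rss

Ω-compat⇒Interleaved : ∀ n r → AllPairs (λ u v → compat u v ≡ true → Interleaved u v) (Ω n r)
Ω-compat⇒Interleaved n r = AllPairs.map compat⇒Interleaved (Ω-ordered n r)

-- `total` is a bijection between the entries of the two lists: distinct chains have distinct
-- totals, and the quotient vertices give a preimage. Duplicate-free lists with the same members
-- have the same length. The size is `suc k` because the preimage is built by dividing by it.
multicliques-Ω : ∀ n r k → length (multicliques (Ω n r) (suc k)) ≡ length (Ω n (r ℕ.* suc k))
multicliques-Ω n r k = trans (sym (Listₚ.length-map total chains))
  (↭ₚ.↭-length (∼bag⇒↭ (unique∧set⇒bag totals-unique
    (Before⇒Unique (Ω-ordered n (r ℕ.* suc k))) (λ {u} → mk⇔ to from))))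
  where
  chains = multicliques (Ω n r) (suc k)
  sound : ∀ {G} → G ∈ chains → AllPairs Interleaved G × All (_∈ Ω n r) G × length G ≡ suc k
  sound = multicliques-sound (suc k) (Ω-compat⇒Interleaved n r)
  totals-unique : Unique (map total chains)
  totals-unique = AllPairsₚ.map⁺ (AllPairs-relativise
    (λ { (rG , _ , lG) (rH , _ , lH) G≢H e → G≢H (total-injective rG rH (trans lG (sym lH)) e) })
    (All.tabulate sound) (multicliques-unique (suc k) (Ω-ordered n r)))
  to : ∀ {u} → u ∈ map total chains → u ∈ Ω n (r ℕ.* suc k)
  to u∈ with ∈ₚ.∈-map⁻ total u∈
  ... | G , G∈ , refl = let _ , G⊆ , l = sound G∈ in
    ∈-Ω⁺ (trans (sumV-total G (All.map (∈-Ω⁻ {n} {r}) G⊆)) (cong (r ℕ.*_) l))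
  from : ∀ {u} → u ∈ Ω n (r ℕ.* suc k) → u ∈ map total chains
  from {u} u∈ = subst (_∈ map total chains) (total-quotientVertices (suc k) 0 u)
    (∈ₚ.∈-map⁺ total (multicliques-complete (suc k) (Ω-ordered n r)
      (AllPairsₚ.applyUpTo⁺₁ (λ m → quotientVertex (suc k) 0 m u) (suc k) (quotientVertex-interleaved (suc k) u))
      (Allₚ.applyUpTo⁺₁ (λ m → quotientVertex (suc k) 0 m u) (suc k) (λ m< → ∈-Ω⁺ (quotientVertex-∈Ω (suc k) u m< (∈-Ω⁻ {n} u∈))))
      (Listₚ.length-applyUpTo (λ m → quotientVertex (suc k) 0 m u) (suc k))))

monomial-coeff : ∀ j k → monomial j k ≡ (if j ℕ.≡ᵇ k then 1ℤ else 0ℤ)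
monomial-coeff zero    zero    = refl
monomial-coeff zero    (suc k) = refl
monomial-coeff (suc j) zero    = refl
monomial-coeff (suc j) (suc k) = monomial-coeff j k

sumS-monomial : ∀ {A : Set} (w : A → ℕ) L m → sumS L (monomial ∘ w) m ≡ + length (filter (λ a → w a ℕ.≟ m) L)
sumS-monomial w []      m = refl
sumS-monomial w (a ∷ L) m rewrite monomial-coeff (w a) m with w a ℕ.≡ᵇ m
... | true  = cong (ℤ._+_ 1ℤ) (sumS-monomial w L m)
... | false = trans (ℤₚ.+-identityˡ _) (sumS-monomial w L m)

-- The bound `R` on the entries is kept apart from the degree `m`, since fixing the first entry x
-- lowers the degree to m - x but leaves the range of the other entries alone. With m ≤ R no vector
-- of coordinate sum m is missed.
powS-ones-allVecs : ∀ n R {m} → m ≤ R → sumS (allVecs n (upTo (suc R))) (monomial ∘ sumV) m ≡ powS ones n m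
powS-ones-allVecs zero    R {m} _   = trans (ℤₚ.+-identityʳ _) (monomial-zero m)
powS-ones-allVecs (suc n) R {m} m≤R = begin
  sumS (allVecs (suc n) xs) (monomial ∘ sumV) m
    ≡⟨ sumS-allVecs-suc n xs (monomial ∘ sumV) m ⟩
  sumS xs (λ x → sumS (allVecs n xs) (λ v → monomial (x ℕ.+ sumV v))) m
    ≡⟨ sumS-cong xs (λ x → S.trans (sumS-cong (allVecs n xs) (λ v → monomial-+ x (sumV v)))
         (S.sym (shift-sumS x (allVecs n xs) (monomial ∘ sumV)))) m ⟩
  sumS xs (λ x → shift x P) m
    ≡⟨ trans (sumS-coeff xs (λ x → shift x P) m) (cong sumℤ (Listₚ.map-upTo (λ x → shift x P m) (suc R))) ⟩
  Σ< (suc R) (λ x → shift x P m)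
    ≡⟨ cong (λ z → Σ< (suc z) (λ x → shift x P m)) (sym (ℕₚ.m+[n∸m]≡n m≤R)) ⟩
  Σ< (suc m ℕ.+ (R ∸ m)) (λ x → shift x P m)
    ≡⟨ Σ<-+ (suc m) (R ∸ m) (λ x → shift x P m) ⟩
  Σ< (suc m) (λ x → shift x P m) ℤ.+ Σ< (R ∸ m) (λ x → shift (suc m ℕ.+ x) P m)
    ≡⟨ cong₂ ℤ._+_ (Σ<-cong (suc m) (λ { (s≤s x≤m) → small x≤m }))
         (trans (Σ<-cong (R ∸ m) {b = λ _ → 0ℤ} (λ {x} _ → shift-< P (ℕₚ.m≤m+n (suc m) x))) (Σ<-zero (R ∸ m))) ⟩
  Σ< (suc m) (λ x → ones x ℤ.* powS ones n (m ∸ x)) ℤ.+ 0ℤ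
    ≡⟨ ℤₚ.+-identityʳ _ ⟩
  Σ< (suc m) (λ x → ones x ℤ.* powS ones n (m ∸ x))
    ≡⟨ cong sumℤ (sym (Listₚ.map-upTo (λ x → ones x ℤ.* powS ones n (m ∸ x)) (suc m))) ⟩
  powS ones (suc n) m ∎
  where
  open ≡-Reasoning
  xs = upTo (suc R)
  P = sumS (allVecs n xs) (monomial ∘ sumV)
  monomial-+ : ∀ x y → monomial (x ℕ.+ y) ≋ shift x (monomial y)
  monomial-+ zero    y k       = refl
  monomial-+ (suc x) y zero    = refl
  monomial-+ (suc x) y (suc k) = monomial-+ x y k
  small : ∀ {x} → x ≤ m → shift x P m ≡ ones x ℤ.* powS ones n (m ∸ x)
  small {x} x≤m = begin
    shift x P m                      ≡⟨ cong (shift x P) (sym (ℕₚ.m+[n∸m]≡n x≤m)) ⟩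
    shift x P (x ℕ.+ (m ∸ x))        ≡⟨ shift-+ x P (m ∸ x) ⟩
    P (m ∸ x)                        ≡⟨ powS-ones-allVecs n R (ℕₚ.≤-trans (ℕₚ.m∸n≤m m x) m≤R) ⟩
    powS ones n (m ∸ x)              ≡⟨ sym (ℤₚ.*-identityˡ _) ⟩
    ones x ℤ.* powS ones n (m ∸ x)   ∎
  Σ<-zero : ∀ d → Σ< d (λ _ → 0ℤ) ≡ 0ℤ
  Σ<-zero zero    = refl
  Σ<-zero (suc d) = trans (ℤₚ.+-identityˡ _) (Σ<-zero d)

length-Ω : ∀ n r → + length (Ω n r) ≡ powS ones n r
length-Ω n r = trans (sym (sumS-monomial sumV (allVecs n (upTo (suc r))) r)) (powS-ones-allVecs n r ℕₚ.≤-refl)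

cliqueSeries-Ω : ∀ n r → cliqueSeries (Ω n r) ≋ E r (powS ones n)
cliqueSeries-Ω n r k = trans (cliqueSeries-multicliques compat-refl compat-sym k (Ω n r)) (count k)
  where
  count : ∀ k → + length (multicliques (Ω n r) k) ≡ powS ones n (r ℕ.* k)
  count zero rewrite ℕₚ.*-zeroʳ r = length-Ω-0 n
    where
    length-Ω-0 : ∀ n → 1ℤ ≡ powS ones n 0
    length-Ω-0 zero    = refl
    length-Ω-0 (suc n) = trans (length-Ω-0 n) (sym (trans (⊛-zero ones (powS ones n)) (ℤₚ.*-identityˡ _)))
  count (suc k) = trans (cong +_ (multicliques-Ω n r k)) (length-Ω n (r ℕ.* suc k))

-- Restriction to a face F

module _ {A : Set} where

  filter-comm : {P Q : A → Set} (P? : Decidable P) (Q? : Decidable Q) (L : List A) →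
    filter P? (filter Q? L) ≡ filter Q? (filter P? L)
  filter-comm P? Q? []      = refl
  filter-comm P? Q? (a ∷ L) with does (Q? a) in eq | does (P? a) in eq′
  ... | true  | true  rewrite eq | eq′ = cong (a ∷_) (filter-comm P? Q? L)
  ... | true  | false rewrite eq′      = filter-comm P? Q? L
  ... | false | true  rewrite eq       = filter-comm P? Q? L
  ... | false | false                  = filter-comm P? Q? L

filter-map : {A B : Set} {P : B → Set} {Q : A → Set} (P? : Decidable P) (Q? : Decidable Q) (f : A → B) →
  (∀ a → does (P? (f a)) ≡ does (Q? a)) → ∀ L → filter P? (map f L) ≡ map f (filter Q? L)
filter-map P? Q? f e []      = refl
filter-map P? Q? f e (a ∷ L) rewrite e a with does (Q? a)
... | true  = cong (f a ∷_) (filter-map P? Q? f e L)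
... | false = filter-map P? Q? f e L

allB-map : {A B : Set} (p : B → Bool) (f : A → B) → ∀ L → allB p (map f L) ≡ allB (p ∘ f) L
allB-map p f []      = refl
allB-map p f (a ∷ L) = cong (p (f a) ∧_) (allB-map p f L)

sublists-map : {A B : Set} (f : A → B) (L : List A) → sublists (map f L) ≡ map (map f) (sublists L)
sublists-map f []      = refl
sublists-map f (a ∷ L) = begin
  sublists (map f L) ++ map (f a ∷_) (sublists (map f L))
    ≡⟨ cong (λ M → M ++ map (f a ∷_) M) (sublists-map f L) ⟩
  map (map f) (sublists L) ++ map (f a ∷_) (map (map f) (sublists L))
    ≡⟨ cong (map (map f) (sublists L) ++_) (trans (sym (Listₚ.map-∘ (sublists L))) (Listₚ.map-∘ (sublists L))) ⟩
  map (map f) (sublists L) ++ map (map f) (map (a ∷_) (sublists L))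
    ≡⟨ sym (Listₚ.map-++ (map f) (sublists L) (map (a ∷_) (sublists L))) ⟩
  map (map f) (sublists (a ∷ L)) ∎
  where open ≡-Reasoning

cliques-map : {A B : Set} {adj : A → A → Bool} {adj′ : B → B → Bool} (f : A → B) →
  (∀ a b → adj′ (f a) (f b) ≡ adj a b) →
  ∀ L → Cliques.cliques adj′ (map f L) ≡ map (map f) (Cliques.cliques adj L)
cliques-map {adj = adj} {adj′} f e L = trans (cong (filterT (Cliques.isClique adj′)) (sublists-map f L))
  (filter-map (λ G → Cliques.isClique adj′ G Boolₚ.≟ true) (λ G → Cliques.isClique adj G Boolₚ.≟ true) (map f)
    (λ G → cong (λ b → does (b Boolₚ.≟ true)) (isClique-map G)) (sublists L))
  where
  isClique-map : ∀ G → Cliques.isClique adj′ (map f G) ≡ Cliques.isClique adj G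
  isClique-map G = trans (allB-map _ f G)
    (allB-cong (λ u → trans (allB-map (adj′ (f u)) f G) (allB-cong (e u) G)) G)

-- Γ_F is the edgewise subdivision of the simplex on F, its vertices being padded with zeros.

pad : ∀ {n} (F : Subset n) → Vec ℕ ∣ F ∣ → Vec ℕ n
pad []          []      = []
pad (true ∷ F)  (a ∷ u) = a ∷ pad F u
pad (false ∷ F) u       = 0 ∷ pad F u

sumV-pad : ∀ {n} (F : Subset n) u → sumV (pad F u) ≡ sumV u
sumV-pad []          []      = refl
sumV-pad (true ∷ F)  (a ∷ u) = cong (a ℕ.+_) (sumV-pad F u)
sumV-pad (false ∷ F) u       = sumV-pad F u

-- A padded zero repeats the preceding prefix sums, so it repeats a test already passed. The
-- hypothesis carries that passed test along; initially both prefix sums are 0.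
diff01-pad : ∀ {n} s s′ (F : Subset n) u v → isBit (s′ ℤ.- s) ≡ true →
  diff01 (ιaux s′ (pad F u)) (ιaux s (pad F v)) ≡ diff01 (ιaux s′ u) (ιaux s v)
diff01-pad s s′ []          []      []      e = refl
diff01-pad s s′ (true ∷ F)  (a ∷ u) (b ∷ v) e with isBit (s′ ℤ.+ + a ℤ.- (s ℤ.+ + b)) in eq
... | true  = diff01-pad (s ℤ.+ + b) (s′ ℤ.+ + a) F u v eq
... | false = refl
diff01-pad s s′ (false ∷ F) u       v       e
  rewrite ℤₚ.+-identityʳ s | ℤₚ.+-identityʳ s′ | e = diff01-pad s s′ F u v e

compat-pad : ∀ {n} (F : Subset n) u v → compat (pad F u) (pad F v) ≡ compat u v
compat-pad F u v = cong₂ _∨_ (diff01-pad 0ℤ 0ℤ F u v refl) (diff01-pad 0ℤ 0ℤ F v u refl)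

supported? : ∀ {n} (F : Subset n) → Decidable (λ u → supportedIn F u ≡ true)
supported? F u = supportedIn F u Boolₚ.≟ true

-- Padding respects the lexicographic order, so the two lists agree in order as well, and lists of
-- faces can be carried over by `map`.
allVecs-supported : ∀ {n} r (F : Subset n) → let xs = upTo (suc r) in
  filter (supported? F) (allVecs n xs) ≡ map (pad F) (allVecs ∣ F ∣ xs)
allVecs-supported r [] = refl
allVecs-supported {suc n} r (true ∷ F) = blocks xs
  where
  open ≡-Reasoning
  xs = upTo (suc r)
  blocks : ∀ ys → filter (supported? (true ∷ F)) (concatMap (λ x → map (x ∷_) (allVecs n xs)) ys) ≡
    map (pad (true ∷ F)) (concatMap (λ x → map (x ∷_) (allVecs ∣ F ∣ xs)) ys)
  blocks []       = refl
  blocks (y ∷ ys) = begin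
    filter (supported? (true ∷ F)) (map (y ∷_) (allVecs n xs) ++ rest)
      ≡⟨ Listₚ.filter-++ (supported? (true ∷ F)) (map (y ∷_) (allVecs n xs)) rest ⟩
    filter (supported? (true ∷ F)) (map (y ∷_) (allVecs n xs)) ++ filter (supported? (true ∷ F)) rest
      ≡⟨ cong₂ _++_ (trans (filter-map _ (supported? F) (y ∷_) (λ _ → refl) (allVecs n xs))
           (cong (map (y ∷_)) (allVecs-supported r F))) (blocks ys) ⟩
    map (y ∷_) (map (pad F) (allVecs ∣ F ∣ xs)) ++ map (pad (true ∷ F)) rest′
      ≡⟨ cong (_++ map (pad (true ∷ F)) rest′) (trans (sym (Listₚ.map-∘ (allVecs ∣ F ∣ xs))) (Listₚ.map-∘ (allVecs ∣ F ∣ xs))) ⟩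
    map (pad (true ∷ F)) (map (y ∷_) (allVecs ∣ F ∣ xs)) ++ map (pad (true ∷ F)) rest′
      ≡⟨ sym (Listₚ.map-++ (pad (true ∷ F)) (map (y ∷_) (allVecs ∣ F ∣ xs)) rest′) ⟩
    map (pad (true ∷ F)) (map (y ∷_) (allVecs ∣ F ∣ xs) ++ rest′) ∎
    where
    rest = concatMap (λ x → map (x ∷_) (allVecs n xs)) ys
    rest′ = concatMap (λ x → map (x ∷_) (allVecs ∣ F ∣ xs)) ys
allVecs-supported {suc n} r (false ∷ F) = begin
  filter (supported? (false ∷ F)) (map (0 ∷_) (allVecs n xs) ++ rest)
    ≡⟨ Listₚ.filter-++ (supported? (false ∷ F)) (map (0 ∷_) (allVecs n xs)) rest ⟩
  filter (supported? (false ∷ F)) (map (0 ∷_) (allVecs n xs)) ++ filter (supported? (false ∷ F)) rest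
    ≡⟨ cong₂ _++_ (trans (filter-map _ (supported? F) (0 ∷_) (λ _ → refl) (allVecs n xs))
         (cong (map (0 ∷_)) (allVecs-supported r F)))
         -- All remaining blocks have a positive first entry, where `false ∷ F` demands 0.
         (Listₚ.filter-none (supported? (false ∷ F)) (Allₚ.concat⁺ (Allₚ.map⁺ (Allₚ.applyUpTo⁺₂ suc r
           (λ i → Allₚ.map⁺ (All.universal (λ v ()) (allVecs n xs))))))) ⟩
  map (0 ∷_) (map (pad F) (allVecs ∣ F ∣ xs)) ++ []
    ≡⟨ Listₚ.++-identityʳ _ ⟩
  map (0 ∷_) (map (pad F) (allVecs ∣ F ∣ xs))
    ≡⟨ sym (Listₚ.map-∘ (allVecs ∣ F ∣ xs)) ⟩
  map (pad (false ∷ F)) (allVecs ∣ F ∣ xs) ∎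
  where
  open ≡-Reasoning
  xs = upTo (suc r)
  rest = concatMap (λ x → map (x ∷_) (allVecs n xs)) (applyUpTo suc r)

vertsF-pad : ∀ {n} r (F : Subset n) → vertsF r F ≡ map (pad F) (Ω ∣ F ∣ r)
vertsF-pad {n} r F = begin
  filter (supported? F) (filter sum? (allVecs n xs)) ≡⟨ filter-comm (supported? F) sum? (allVecs n xs) ⟩
  filter sum? (filter (supported? F) (allVecs n xs)) ≡⟨ cong (filter sum?) (allVecs-supported r F) ⟩
  filter sum? (map (pad F) (allVecs ∣ F ∣ xs))
    ≡⟨ filter-map sum? sum? (pad F) (λ u → cong (λ z → does (z ℕ.≟ r)) (sumV-pad F u)) (allVecs ∣ F ∣ xs) ⟩
  map (pad F) (Ω ∣ F ∣ r) ∎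
  where
  open ≡-Reasoning
  xs = upTo (suc r)
  sum? : ∀ {m} → Decidable (λ (u : Vec ℕ m) → sumV u ≡ r)
  sum? u = sumV u ℕ.≟ r

facesF-pad : ∀ {n} r (F : Subset n) → facesF r F ≡ map (map (pad F)) (cliques (Ω ∣ F ∣ r))
-- `facesF r F` unfolds to `cliques (vertsF r F)`, since `isFace` is `isClique` for the adjacency
-- `compat`.
facesF-pad r F = trans (cong cliques (vertsF-pad r F)) (cliques-map (pad F) (compat-pad F) (Ω ∣ F ∣ r))

-- The h-polynomials of the restrictions and the local h-polynomial

-- Read in the order of `Ω`, a clique is a strict chain of interleaved vectors, to which the
-- dimension bound applies.
Ω-clique-length : ∀ n r → 1 ≤ r → All (λ G → length G ≤ n) (cliques (Ω n r))
Ω-clique-length n r 1≤r = All.zipWith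
  (λ { {G} (clique , ordered , sums) → strict-chain-length 1≤r G
    (AllPairs.zipWith (λ { (e , ¬r) → compat⇒Interleaved ¬r e , ¬r })
      (isClique⇒AllPairs compat-refl compat-sym G clique , ordered)) sums })
  (Allₚ.all-filter isClique? (sublists (Ω n r)) ,
   Allₚ.filter⁺ isClique? (All.zipWith id (AllPairs-sublists (Ω-ordered n r) ,
     All-sublists (Allₚ.all-filter (λ u → sumV u ℕ.≟ r) (allVecs n (upTo (suc r)))))))
  where isClique? = λ G → isClique G Boolₚ.≟ true

hPoly-E : ∀ {n} r (F : Subset n) → 1 ≤ r → hPoly r F ≋ E r (powS (oneS ⊕ geomS r) ∣ F ∣)
hPoly-E {n} r F 1≤r k = begin
  hPoly r F k
    ≡⟨ sumS-fibres length (facesF r F) d φ faces-length k ⟩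
  sumS (facesF r F) (φ ∘ length) k
    ≡⟨ cong (λ L → sumS L (φ ∘ length) k) (facesF-pad r F) ⟩
  sumS (map (map (pad F)) faces) (φ ∘ length) k
    ≡⟨ sumS-map (map (pad F)) faces (φ ∘ length) k ⟩
  sumS faces (φ ∘ length ∘ map (pad F)) k
    ≡⟨ sumS-cong-All (All.map (λ {G} l → subst (λ m → φ m ≋ powS oneMinusX d ⊛ powS X/1-X (length G))
         (sym (Listₚ.length-map (pad F) G)) (monomial-⊛-oneMinusX l)) (Ω-clique-length d r 1≤r)) k ⟩
  sumS faces (λ G → powS oneMinusX d ⊛ powS X/1-X (length G)) k
    ≡⟨ sym (⊛-sumS (powS oneMinusX d) faces (λ G → powS X/1-X (length G)) k) ⟩
  (powS oneMinusX d ⊛ cliqueSeries (Ω d r)) k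
    ≡⟨ S.*-congˡ {powS oneMinusX d} (cliqueSeries-Ω d r) k ⟩
  (powS oneMinusX d ⊛ E r (powS ones d)) k
    ≡⟨ E-powS-ones r 1≤r d k ⟩
  E r (powS (oneS ⊕ geomS r) d) k ∎
  where
  open ≡-Reasoning
  d = ∣ F ∣
  faces = cliques (Ω d r)
  φ : ℕ → Series
  φ i = monomial i ⊛ powS oneMinusX (d ∸ i)
  faces-length : All (λ G → length G ≤ d) (facesF r F)
  faces-length = subst (All (λ G → length G ≤ d)) (sym (facesF-pad r F))
    (Allₚ.map⁺ (All.map (λ {G} → subst (_≤ d) (sym (Listₚ.length-map (pad F) G))) (Ω-clique-length d r 1≤r)))
  sumS-cong-All : ∀ {A : Set} {L : List A} {f g} → All (λ a → f a ≋ g a) L → sumS L f ≋ sumS L g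
  sumS-cong-All []       k = refl
  sumS-cong-All (e ∷ es) k = cong₂ ℤ._+_ (e k) (sumS-cong-All es k)

E-sumS : ∀ {A : Set} r (L : List A) f → E r (sumS L f) ≋ sumS L (λ a → E r (f a))
E-sumS r []      f k = refl
E-sumS r (a ∷ L) f k = cong (ℤ._+_ (f a (r ℕ.* k))) (E-sumS r L f k)

localH-E : ∀ n r → 1 ≤ r → localH n r ≋ E r (powS (geomS r) n)
localH-E n r 1≤r k = begin
  localH n r k
    ≡⟨ sumS-cong subsets (λ F k → cong (ℤ._*_ (-1ℤ ℤ.^ (n ∸ ∣ F ∣))) (hPoly-E r F 1≤r k)) k ⟩
  sumS subsets (λ F → E r (scale (-1ℤ ℤ.^ (n ∸ ∣ F ∣)) (powS (oneS ⊕ geomS r) ∣ F ∣))) k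
    ≡⟨ sym (E-sumS r subsets _ k) ⟩
  sumS subsets (λ F → scale (-1ℤ ℤ.^ (n ∸ ∣ F ∣)) (powS (oneS ⊕ geomS r) ∣ F ∣)) (r ℕ.* k)
    ≡⟨ alternating-subsets (geomS r) n (r ℕ.* k) ⟩
  E r (powS (geomS r) n) k ∎
  where
  open ≡-Reasoning
  subsets = allVecs n (true ∷ false ∷ [])

theorem1p1 : (n r : ℕ) → 1 ≤ n → 1 ≤ r →
    ((k : ℕ) → localH n r k ≡ E r (powS (geomS r) n) k)
    × ((k : ℕ) → E r (powS (geomS r) n) k ≡ ascPoly n r k)
theorem1p1 n r _ 1≤r = localH-E n r 1≤r , E-geomS-ascPoly n r 1≤r
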